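{- There is an asymptotic fully polynomial time approximation scheme (AFPTAS) for the bin packing type variant of the generalized extensible bin packing problem. That is, there exist a function $g$ and, for every $\varepsilon>0$, an algorithm that, given any instance $I$ of this variant with $\max_{i} f_i=1$, outputs a feasible solution of cost at most $(1+\varepsilon)\cdot cost(\mathrm{opt}(I))+g(1/\varepsilon)$, where $cost(\mathrm{opt}(I))$ is the minimum cost of a feasible solution of $I$, and whose running time is bounded by a polynomial in $1/\varepsilon$ and the length of the binary encoding of $I$.
   Context: Bin packing type variant of generalized extensible bin packing: an instance consists of $n$ jobs, where job $j$ has size $p_j\ge 0$, and $m$ machine types, where type $i\in\{1,\dots,m\}$ is given by three positive numbers $f_i$ (fixed cost), $c_i$ (standard capacity), $\sigma_i$ (cost per unit of overtime) satisfying $f_i=c_i\cdot\sigma_i$. A feasible solution first chooses, for every $i$, a non-negative integer number of machines of type $i$, and then assigns every job to one of the chosen machines. A chosen machine of type $i$ whose assigned jobs have total size (load) $L$ costs $cost_i(L)=f_i$ if $L\le c_i$, and $cost_i(L)=f_i+\sigma_i(L-c_i)$ otherwise. The cost of the solution is the sum of the costs of all chosen machines, and it is to be minimized. -}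

module Defs where

open import Algebra.Properties.CommutativeMonoid.Sum using (sum)
open import Data.Bool.Base using (if_then_else_)
open import Data.Fin.Base using (Fin; zero; toℕ)
import Data.Fin.Properties as Fin
open import Data.Integer.Base using (∣_∣)
import Data.Integer.Base as ℤ
open import Data.Nat.Base as ℕ using (ℕ; suc)
open import Data.Nat.Binary.Base as ℕᵇ using (ℕᵇ; 2[1+_]; 1+[2_])
open import Data.Product.Base using (Σ; _×_; _,_; proj₁; proj₂; ∃-syntax)
open import Data.Product.Properties using (≡-dec)
open import Data.Rational.Base
  using (ℚ; 0ℚ; ↥_; ↧ₙ_; _+_; _*_; _-_; _≤_; _<_; 1/_; Positive; _/_)
open import Data.Rational.Properties
  using (_≤?_; pos⇒nonZero; +-0-commutativeMonoid)
open import Data.Vec.Base using (Vec; _∷_; lookup; replicate; _[_]≔_)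
open import Data.Vec.Functional using (Vector; foldr)
open import Function.Base using (_∘_)
open import Relation.Binary.PropositionalEquality.Core using (_≡_)
open import Relation.Nullary.Decidable.Core using (⌊_⌋)

-- Generalized extensible bin packing, bin packing type variant

record Instance : Set where
  field
    n m   : ℕ
    p     : Fin n → ℚ
    f c σ : Fin m → ℚ
    p≥0   : ∀ j → 0ℚ ≤ p j
    f>0   : ∀ i → 0ℚ < f i
    c>0   : ∀ i → 0ℚ < c i
    σ>0   : ∀ i → 0ℚ < σ i
    f≡c*σ : ∀ i → f i ≡ c i * σ i

MaxFixedCost : Instance → ℚ → Set
MaxFixedCost I v = (∀ i → f i ≤ v) × (∃[ i ] f i ≡ v)
  where open Instance I

record Solution (I : Instance) : Set where
  open Instance I
  field
    count  : Fin m → ℕ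
    assign : Fin n → Σ (Fin m) (Fin ∘ count)

∑ : ∀ {k} → (Fin k → ℚ) → ℚ
∑ = sum +-0-commutativeMonoid

machineCost : (I : Instance) → Fin (Instance.m I) → ℚ → ℚ
machineCost I i L =
  if ⌊ L ≤? c i ⌋ then f i else f i + σ i * (L - c i)
  where open Instance I

module _ {I : Instance} (s : Solution I) where
  open Instance I
  open Solution s

  load : (i : Fin m) → Fin (count i) → ℚ
  load i l =
    ∑ λ j → if ⌊ ≡-dec Fin._≟_ Fin._≟_ (assign j) (i , l) ⌋ then p j else 0ℚ

  cost : ℚ
  cost = ∑ λ i → ∑ λ l → machineCost I i (load i l)

Optimal : {I : Instance} → Solution I → Set
Optimal {I} o = (s : Solution I) → cost o ≤ cost s

-- Algorithms: the imperative WHILE language over binary trees (N. D. Jones,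
-- "Computability and Complexity"), with logarithmic-style costs: every use of
-- a variable is charged the full size of the tree it holds.  Hence no tree can
-- be shared or copied for free, the running time bounds the size of every
-- computed value, and running times agree with those of multitape Turing
-- machines up to a polynomial.

data Tree : Set where
  leaf : Tree
  _∙_  : Tree → Tree → Tree

-- Also the length of the preorder bit string of the tree (0 for a leaf, 1 for
-- an inner vertex).
size : Tree → ℕ
size leaf    = 1
size (t ∙ u) = suc (size t ℕ.+ size u)

data Expr (k : ℕ) : Set where
  var   : Fin k → Expr k
  nil   : Expr k
  cons  : Expr k → Expr k → Expr k
  hd tl : Expr k → Expr k

data Cmd (k : ℕ) : Set where
  _:=_          : Fin k → Expr k → Cmd k
  _⨟_           : Cmd k → Cmd k → Cmd k
  while_loop_   : Expr k → Cmd k → Cmd k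
  test_yes_no_  : Expr k → Cmd k → Cmd k → Cmd k

Store : ℕ → Set
Store = Vec Tree

left right : Tree → Tree
left  leaf    = leaf
left  (t ∙ _) = t
right leaf    = leaf
right (_ ∙ u) = u

module _ {k : ℕ} (ρ : Store k) where

  eval : Expr k → Tree
  eval (var x)    = lookup ρ x
  eval nil        = leaf
  eval (cons e d) = eval e ∙ eval d
  eval (hd e)     = left (eval e)
  eval (tl e)     = right (eval e)

  evalTime : Expr k → ℕ
  evalTime (var x)    = size (lookup ρ x)
  evalTime nil        = 1
  evalTime (cons e d) = suc (evalTime e ℕ.+ evalTime d)
  evalTime (hd e)     = suc (evalTime e)
  evalTime (tl e)     = suc (evalTime e)

-- ⟨ C , ρ ⟩⇓[ t ] ρ′: started in store ρ, the command C halts after time t in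
-- store ρ′.  In tests, leaf means false and every other tree means true.
data ⟨_,_⟩⇓[_]_ {k : ℕ} : Cmd k → Store k → ℕ → Store k → Set where

  set : ∀ {x e ρ} →
    ⟨ x := e , ρ ⟩⇓[ suc (evalTime ρ e) ] (ρ [ x ]≔ eval ρ e)

  seq : ∀ {C D ρ ρ′ ρ″ t u} →
    ⟨ C , ρ ⟩⇓[ t ] ρ′ →
    ⟨ D , ρ′ ⟩⇓[ u ] ρ″ →
    ⟨ C ⨟ D , ρ ⟩⇓[ t ℕ.+ u ] ρ″

  while-done : ∀ {e C ρ} →
    eval ρ e ≡ leaf →
    ⟨ while e loop C , ρ ⟩⇓[ suc (evalTime ρ e) ] ρ

  while-step : ∀ {e C ρ ρ′ ρ″ a b t u} →
    eval ρ e ≡ a ∙ b →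
    ⟨ C , ρ ⟩⇓[ t ] ρ′ →
    ⟨ while e loop C , ρ′ ⟩⇓[ u ] ρ″ →
    ⟨ while e loop C , ρ ⟩⇓[ suc (evalTime ρ e) ℕ.+ t ℕ.+ u ] ρ″

  test-yes : ∀ {e C D ρ ρ′ a b t} →
    eval ρ e ≡ a ∙ b →
    ⟨ C , ρ ⟩⇓[ t ] ρ′ →
    ⟨ test e yes C no D , ρ ⟩⇓[ suc (evalTime ρ e) ℕ.+ t ] ρ′

  test-no : ∀ {e C D ρ ρ′ t} →
    eval ρ e ≡ leaf →
    ⟨ D , ρ ⟩⇓[ t ] ρ′ →
    ⟨ test e yes C no D , ρ ⟩⇓[ suc (evalTime ρ e) ℕ.+ t ] ρ′

-- Variable 0 holds the input at the start and the output at the end; all other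
-- variables are initially leaf.
record Program : Set where
  field
    {extraVars} : ℕ
    body        : Cmd (suc extraVars)

_on_outputs_inTime_ : Program → Tree → Tree → ℕ → Set
P on x outputs y inTime t =
  ∃[ ρ ] (⟨ body , x ∷ replicate extraVars leaf ⟩⇓[ t ] ρ) × (lookup ρ zero ≡ y)
  where open Program P

-- Binary encodings

encodeℕᵇ : ℕᵇ → Tree
encodeℕᵇ ℕᵇ.zero  = leaf
encodeℕᵇ 2[1+ b ] = leaf ∙ encodeℕᵇ b
encodeℕᵇ 1+[2 b ] = (leaf ∙ leaf) ∙ encodeℕᵇ b

encodeℕ : ℕ → Tree
encodeℕ = encodeℕᵇ ∘ ℕᵇ.fromℕ

-- The sign is dropped: only nonnegative rationals occur in instances.
encodeℚ≥0 : ℚ → Tree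
encodeℚ≥0 q = encodeℕ ∣ ↥ q ∣ ∙ encodeℕ (↧ₙ q)

encodeList : ∀ {k} → Vector Tree k → Tree
encodeList = foldr _∙_ leaf

encodeInstance : Instance → Tree
encodeInstance I =
  encodeList (encodeℚ≥0 ∘ p) ∙
  encodeList (λ i → encodeℚ≥0 (f i) ∙ (encodeℚ≥0 (c i) ∙ encodeℚ≥0 (σ i)))
  where open Instance I

encodeSolution : {I : Instance} → Solution I → Tree
encodeSolution s =
  encodeList (encodeℕ ∘ count) ∙
  encodeList λ j →
    encodeℕ (toℕ (proj₁ (assign j))) ∙ encodeℕ (toℕ (proj₂ (assign j)))
  where open Solution s

-- Length of the binary encoding of an instance.
∥_∥ : Instance → ℕ
∥ I ∥ = size (encodeInstance I)

-- Polynomials in two variables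

data Poly₂ : Set where
  con     : ℚ → Poly₂
  X Y     : Poly₂
  _⊕_ _⊗_ : Poly₂ → Poly₂ → Poly₂

⟦_⟧ : Poly₂ → ℚ → ℚ → ℚ
⟦ con a ⟧ x y = a
⟦ X     ⟧ x y = x
⟦ Y     ⟧ x y = y
⟦ q ⊕ r ⟧ x y = ⟦ q ⟧ x y + ⟦ r ⟧ x y
⟦ q ⊗ r ⟧ x y = ⟦ q ⟧ x y * ⟦ r ⟧ x y

fromℕ : ℕ → ℚ
fromℕ k = ℤ.+ k / 1

inverse : (ε : ℚ) .{{_ : Positive ε}} → ℚ
inverse ε = (1/ ε) {{pos⇒nonZero ε}}

{-# OPTIONS --safe #-}

-- Since f = c σ, a machine with load L costs σ max(c, L) ≥ σ L.  Hence every
-- solution costs at least τ times the total size of the jobs, where τ is the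
-- least σ, whereas a single machine of a type with σ = τ that receives all jobs
-- costs at most f ≤ 1 more than that.  So the additive constant 1 suffices, with
-- the same program for every ε; it only has to find a type with least σ, and it
-- does so by comparing cross products in bijective binary arithmetic.

module Submission where

open import Algebra.Properties.CommutativeMonoid.Sum using (∑-comm; sum-cong-≗; sum-replicate-zero)
open import Data.Bool.Base using (Bool; true; false; if_then_else_)
open import Data.Empty using (⊥)
open import Data.Fin.Base as Fin using (Fin; zero; suc)
open import Data.Fin.Patterns using (0F; 1F; 2F; 3F; 4F; 5F; 6F; 7F; 8F; 9F)
import Data.Fin.Properties as Fin
open import Data.Integer.Base as ℤ using (-[1+_])
import Data.Integer.Properties as ℤ
open import Data.List.Base as List
  using (List; []; _∷_; length; foldl; foldr; reverse; upTo; allFin; map; concatMap; cartesianProductWith)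
open import Data.List.Membership.Propositional using (_∈_; lose)
open import Data.List.Membership.Propositional.Properties
  using (∈-map⁺; ∈-concatMap⁺; ∈-cartesianProductWith⁺; ∈-allFin; ∈-upTo⁺)
open import Data.List.Properties using (reverse-foldl; length-reverse)
open import Data.List.Relation.Binary.Permutation.Propositional using (↭-sym)
open import Data.List.Relation.Binary.Permutation.Propositional.Properties using (All-resp-↭; ↭-reverse)
import Data.List.Relation.Unary.All as LAll
import Data.List.Relation.Unary.All.Properties as LAll
open import Data.List.Relation.Unary.Any using (here)
open import Data.Nat.Base as ℕ using (ℕ; zero; suc; z≤n; s≤s)
open import Data.Nat.Binary.Base as ℕᵇ using (ℕᵇ; zero; 2[1+_]; 1+[2_]; toℕ)
import Data.Nat.Binary.Properties as ℕᵇ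
open import Data.Nat.Coprimality using (1-coprimeTo) renaming (sym to coprime-sym)
import Data.Nat.Properties as ℕ
open import Data.Nat.Tactic.RingSolver using (solve-∀)
open import Data.Product.Base using (Σ; Σ-syntax; ∃-syntax; _×_; _,_; proj₁; proj₂)
open import Data.Product.Properties using (≡-dec)
open import Data.Unit.Base using (⊤)
open import Data.Vec.Base as Vec using (Vec; []; _∷_; lookup; tabulate; _[_]≔_)
open import Data.Vec.Properties using (lookup∘tabulate)
open import Data.Vec.Relation.Unary.All as All using (All; []; _∷_)
open import Data.Vec.Relation.Unary.All.Properties using (lookup⁺)
open import Function.Base using (_∘_; _∘′_; flip)
open import Relation.Binary.Bundles using (DecTotalOrder)
open import Relation.Binary.Definitions using (DecidableEquality)
open import Relation.Binary.PropositionalEquality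
  using (_≡_; refl; sym; trans; cong; cong₂; subst; subst₂; subst-sym-subst; module ≡-Reasoning)
open import Relation.Nullary.Decidable.Core using (Dec; yes; no; ⌊_⌋)
open import Relation.Nullary.Negation using (¬_; contradiction)
open import Defs

-- Two obligations shape the development. The first is the running time. Each use of a variable
-- costs the size of its tree, so every intermediate store needs a size bound. One bound `B` is
-- fixed for the whole run, and after each piece of the program it is re-established from the values
-- computed; merely multiplying growth factors would compound them from round to round of a loop.
-- The final `B` is 8 (n + 1)^2 for input length n: cross products of two rates have at most 2n
-- binary digits, and the output repeats the index of the chosen type for every job, hence the
-- square. The second is the existence of an optimum, which the statement asserts. There may be
-- infinitely many solutions, because idle machines can be added without limit. But each machine of
-- type `i` costs at least `f i > 0`, so only finitely many count vectors can beat a given solution,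
-- and for fixed counts there are finitely many assignments.

module Programs where

  open import Data.Nat.Base
  open import Data.Nat.Properties

  private variable
    k : ℕ

  -- Running times under a uniform size bound

  Bounded : ℕ → Store k → Set
  Bounded B = All (λ t → size t ≤ B)

  All-[]≔ : ∀ {A : Set} {P : A → Set} {n} {xs : Vec A n} {x} i →
            All P xs → P x → All P (xs [ i ]≔ x)
  All-[]≔ zero    (_  ∷ ps) p = p ∷ ps
  All-[]≔ (suc i) (p₀ ∷ ps) p = p₀ ∷ All-[]≔ i ps p

  nodes : Expr k → ℕ
  nodes (var _)    = 1
  nodes nil        = 1
  nodes (cons e d) = suc (nodes e + nodes d)
  nodes (hd e)     = suc (nodes e)
  nodes (tl e)     = suc (nodes e)

  size>0 : ∀ t → 1 ≤ size t
  size>0 leaf    = s≤s z≤n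
  size>0 (_ ∙ _) = s≤s z≤n

  size-left : ∀ t → size (left t) ≤ size t
  size-left leaf    = ≤-refl
  size-left (t ∙ u) = m≤n⇒m≤1+n (m≤m+n (size t) (size u))

  size-right : ∀ t → size (right t) ≤ size t
  size-right leaf    = ≤-refl
  size-right (t ∙ u) = m≤n⇒m≤1+n (m≤n+m (size u) (size t))

  size-eval : (ρ : Store k) (e : Expr k) → size (eval ρ e) ≤ evalTime ρ e
  size-eval ρ (var x)    = ≤-refl
  size-eval ρ nil        = ≤-refl
  size-eval ρ (cons e d) = s≤s (+-mono-≤ (size-eval ρ e) (size-eval ρ d))
  size-eval ρ (hd e)     = m≤n⇒m≤1+n (≤-trans (size-left (eval ρ e)) (size-eval ρ e))
  size-eval ρ (tl e)     = m≤n⇒m≤1+n (≤-trans (size-right (eval ρ e)) (size-eval ρ e))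

  -- Each node of the expression is charged at most `B`: a variable because its tree is bounded,
  -- every other node because it costs 1 and `1 ≤ B`.
  evalTime-≤ : ∀ {B} {ρ : Store k} e → 1 ≤ B → Bounded B ρ → evalTime ρ e ≤ nodes e * B
  evalTime-≤ {B = B} (var x) 1≤B b = ≤-trans (lookup⁺ b x) (≤-reflexive (sym (*-identityˡ B)))
  evalTime-≤ {B = B} nil     1≤B b = ≤-trans 1≤B (≤-reflexive (sym (*-identityˡ B)))
  evalTime-≤ {B = B} (cons e d) 1≤B b = +-mono-≤ 1≤B
    (≤-trans (+-mono-≤ (evalTime-≤ e 1≤B b) (evalTime-≤ d 1≤B b))
             (≤-reflexive (sym (*-distribʳ-+ B (nodes e) (nodes d)))))
  evalTime-≤ (hd e) 1≤B b = +-mono-≤ 1≤B (evalTime-≤ e 1≤B b)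
  evalTime-≤ (tl e) 1≤B b = +-mono-≤ 1≤B (evalTime-≤ e 1≤B b)

  -- Hides the exact time behind an upper bound, so that the bounds of composed commands simply add
  -- up.
  record Exec {k} (C : Cmd k) (ρ ρ′ : Store k) (T : ℕ) : Set where
    constructor within
    field
      {time} : ℕ
      halts  : ⟨ C , ρ ⟩⇓[ time ] ρ′
      time≤  : time ≤ T

  weaken : ∀ {C : Cmd k} {ρ ρ′ T U} → T ≤ U → Exec C ρ ρ′ T → Exec C ρ ρ′ U
  weaken T≤U (within d t≤T) = within d (≤-trans t≤T T≤U)

  infixr 5 _⟫_
  _⟫_ : ∀ {C D : Cmd k} {ρ ρ′ ρ″ T U} →
        Exec C ρ ρ′ T → Exec D ρ′ ρ″ U → Exec (C ⨟ D) ρ ρ″ (T + U)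
  within c t≤ ⟫ within d u≤ = within (seq c d) (+-mono-≤ t≤ u≤)

  exec-yes : ∀ {B} {e} {C D : Cmd k} {ρ ρ′ a b T} → 1 ≤ B → Bounded B ρ → eval ρ e ≡ a ∙ b →
             Exec C ρ ρ′ T → Exec (test e yes C no D) ρ ρ′ (suc (nodes e) * B + T)
  exec-yes {e = e} 1≤B bρ eq (within c t≤) =
    within (test-yes eq c) (+-mono-≤ (+-mono-≤ 1≤B (evalTime-≤ e 1≤B bρ)) t≤)

  exec-no : ∀ {B} {e} {C D : Cmd k} {ρ ρ′ T} → 1 ≤ B → Bounded B ρ → eval ρ e ≡ leaf →
            Exec D ρ ρ′ T → Exec (test e yes C no D) ρ ρ′ (suc (nodes e) * B + T)
  exec-no {e = e} 1≤B bρ eq (within c t≤) =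
    within (test-no eq c) (+-mono-≤ (+-mono-≤ 1≤B (evalTime-≤ e 1≤B bρ)) t≤)

  opaque
    -- `n` bounds the number of rounds and `T` the time of one body. Each test of a variable costs
    -- at most `1 + B`, hence at most `2 * B`; the leading `2 * B` pays for the final failing test.
    -- Opacity keeps nested bounds symbolic.
    loopTime : ℕ → ℕ → ℕ → ℕ
    loopTime B T n = 2 * B + n * (2 * B + T)

    loop-done : ∀ {B T n x} {C : Cmd k} {ρ} → 1 ≤ B → Bounded B ρ → lookup ρ x ≡ leaf →
                Exec (while var x loop C) ρ ρ (loopTime B T n)
    loop-done {B = B} {x = x} 1≤B bρ eq =
      within (while-done eq) (≤-trans (+-mono-≤ 1≤B (evalTime-≤ (var x) 1≤B bρ)) (m≤m+n (2 * B) _))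

    loop-step : ∀ {B T n x} {C : Cmd k} {ρ ρ′ ρ″ a b} → 1 ≤ B → Bounded B ρ → lookup ρ x ≡ a ∙ b →
                Exec C ρ ρ′ T →
                Exec (while var x loop C) ρ′ ρ″ (loopTime B T n) →
                Exec (while var x loop C) ρ ρ″ (loopTime B T (suc n))
    loop-step {B = B} {T = T} {n = n} {x = x} 1≤B bρ eq (within c t≤) (within d u≤) =
      within (while-step eq c d)
        (≤-trans (+-mono-≤ (+-mono-≤ (+-mono-≤ 1≤B (evalTime-≤ (var x) 1≤B bρ)) t≤) u≤)
                 (≤-reflexive (rearrange (2 * B) T (n * (2 * B + T)))))
      where
      rearrange : ∀ w t r → w + t + (w + r) ≡ w + ((w + t) + r)
      rearrange = solve-∀

    loopTime-≡ : ∀ B T n → loopTime B T n ≡ 2 * B + n * (2 * B + T)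
    loopTime-≡ B T n = refl

  -- Loop-free commands

  branch : Tree → Store k → Store k → Store k
  branch leaf    ρ ρ′ = ρ′
  branch (_ ∙ _) ρ ρ′ = ρ

  -- Meaningful for loop-free commands only.
  run : Cmd k → Store k → Store k
  run (x := e)              ρ = ρ [ x ]≔ eval ρ e
  run (C ⨟ D)               ρ = run D (run C ρ)
  run (while _ loop _)      ρ = ρ
  run (test e yes C no D)   ρ = branch (eval ρ e) (run C ρ) (run D ρ)

  LoopFree : Cmd k → Set
  LoopFree (_ := _)            = ⊤
  LoopFree (C ⨟ D)             = LoopFree C × LoopFree D
  LoopFree (while _ loop _)    = ⊥
  LoopFree (test _ yes C no D) = LoopFree C × LoopFree D

  -- The factor by which the command may enlarge the size bound of the store. The sum of the two
  -- branches of a test stands in for their maximum.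
  growth : Cmd k → ℕ
  growth (_ := e)            = suc (nodes e)
  growth (C ⨟ D)             = growth D * growth C
  growth (while _ loop _)    = 0
  growth (test _ yes C no D) = growth C + growth D

  -- Time in units of the size bound. The second command of a sequence starts from a store already
  -- enlarged by `growth C`, which explains the product.
  steps : Cmd k → ℕ
  steps (_ := e)            = suc (nodes e)
  steps (C ⨟ D)             = steps C + steps D * growth C
  steps (while _ loop _)    = 0
  steps (test e yes C no D) = suc (nodes e) + (steps C + steps D)

  Bounded-mono : ∀ {B B′} {ρ : Store k} → B ≤ B′ → Bounded B ρ → Bounded B′ ρ
  Bounded-mono B≤B′ = All.map (λ b → ≤-trans b B≤B′)

  growth>0 : (C : Cmd k) → LoopFree C → 1 ≤ growth C
  growth>0 (_ := e)            _         = s≤s z≤n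
  growth>0 (C ⨟ D)             (lc , ld) = *-mono-≤ (growth>0 D ld) (growth>0 C lc)
  growth>0 (test _ yes C no D) (lc , ld) = ≤-trans (growth>0 C lc) (m≤m+n _ _)

  run-bounded : ∀ {B} {ρ : Store k} (C : Cmd k) → LoopFree C → 1 ≤ B → Bounded B ρ →
                Bounded (growth C * B) (run C ρ)
  run-bounded {B = B} {ρ} (x := e) _ 1≤B bρ =
    All-[]≔ x (Bounded-mono (m≤m+n B _) bρ)
      (≤-trans (size-eval ρ e) (≤-trans (evalTime-≤ e 1≤B bρ) (m≤n+m _ B)))
  run-bounded {B = B} {ρ} (C ⨟ D) (lc , ld) 1≤B bρ =
    subst (λ b → Bounded b (run D (run C ρ))) (sym (*-assoc (growth D) (growth C) B))
      (run-bounded D ld (*-mono-≤ (growth>0 C lc) 1≤B) (run-bounded C lc 1≤B bρ))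
  run-bounded {B = B} {ρ} (test e yes C no D) (lc , ld) 1≤B bρ with eval ρ e
  ... | leaf  = Bounded-mono (*-monoˡ-≤ B (m≤n+m (growth D) (growth C))) (run-bounded D ld 1≤B bρ)
  ... | _ ∙ _ = Bounded-mono (*-monoˡ-≤ B (m≤m+n (growth C) (growth D))) (run-bounded C lc 1≤B bρ)

  private
    test-≤ : ∀ {B s s′} n → s ≤ s′ → suc n * B + s * B ≤ (suc n + s′) * B
    test-≤ {B} {s} n s≤s′ = ≤-trans (≤-reflexive (sym (*-distribʳ-+ B (suc n) s)))
                                    (*-monoˡ-≤ B (+-monoʳ-≤ (suc n) s≤s′))

  exec-loopFree : ∀ {B} {ρ : Store k} (C : Cmd k) {lf : LoopFree C} → 1 ≤ B → Bounded B ρ →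
             Exec C ρ (run C ρ) (steps C * B)
  exec-loopFree (x := e) 1≤B bρ = within set (+-mono-≤ 1≤B (evalTime-≤ e 1≤B bρ))
  exec-loopFree {B = B} (C ⨟ D) {lc , ld} 1≤B bρ =
    weaken (≤-reflexive eq)
      (exec-loopFree C {lc} 1≤B bρ ⟫
       exec-loopFree D {ld} (*-mono-≤ (growth>0 C lc) 1≤B) (run-bounded C lc 1≤B bρ))
    where
    eq : steps C * B + steps D * (growth C * B) ≡ (steps C + steps D * growth C) * B
    eq = trans (cong (steps C * B +_) (sym (*-assoc (steps D) (growth C) B)))
               (sym (*-distribʳ-+ B (steps C) (steps D * growth C)))
  exec-loopFree {B = B} {ρ} (test e yes C no D) {lc , ld} 1≤B bρ with eval ρ e in eq
  ... | leaf  = weaken (test-≤ (nodes e) (m≤n+m (steps D) (steps C)))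
                       (exec-no 1≤B bρ eq (exec-loopFree D {ld} 1≤B bρ))
  ... | _ ∙ _ = weaken (test-≤ (nodes e) (m≤m+n (steps C) (steps D)))
                       (exec-yes 1≤B bρ eq (exec-loopFree C {lc} 1≤B bρ))

  opaque
    straightTime : Cmd k → ℕ → ℕ
    straightTime C B = steps C * B

    straightTime-≡ : (C : Cmd k) (B : ℕ) → straightTime C B ≡ steps C * B
    straightTime-≡ C B = refl

    -- Verification of loop-free code by computation: the final store is found by evaluating `run`,
    -- often with `refl`. Growth is accounted for only inside `C`; the caller bounds the resulting
    -- store afresh by `B`.
    exec-run : ∀ {B} {ρ ρ′ : Store k} (C : Cmd k) {lf : LoopFree C} → 1 ≤ B → Bounded B ρ →
               run C ρ ≡ ρ′ → Exec C ρ ρ′ (straightTime C B)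
    exec-run C {lf} 1≤B bρ refl = exec-loopFree C {lf} 1≤B bρ

  -- Binary addition

  infix  5 _≔_
  infixr 4 _⨾_

  _≔_ : Fin k → Expr k → Cmd k
  _≔_ = _:=_

  _⨾_ : Cmd k → Cmd k → Cmd k
  _⨾_ = _⨟_

  skip : Cmd (suc k)
  skip = 0F ≔ var 0F

  unary : ℕ → Tree
  unary zero    = leaf
  unary (suc n) = leaf ∙ unary n

  ⌜_⌝ : ℕᵇ → Tree
  ⌜_⌝ = encodeℕᵇ

  run-⨾ : (C D : Cmd k) (ρ : Store k) → run (C ⨾ D) ρ ≡ run D (run C ρ)
  run-⨾ C D ρ = refl

  rev : Tree → Tree → Tree
  rev leaf    z = z
  rev (h ∙ r) z = rev r (h ∙ z)

  revᵇ : ℕᵇ → ℕᵇ → ℕᵇ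
  revᵇ zero     z = z
  revᵇ 2[1+ r ] z = revᵇ r 2[1+ z ]
  revᵇ 1+[2 r ] z = revᵇ r 1+[2 z ]

  rev-⌜⌝ : ∀ r z → rev ⌜ r ⌝ ⌜ z ⌝ ≡ ⌜ revᵇ r z ⌝
  rev-⌜⌝ zero     z = refl
  rev-⌜⌝ 2[1+ r ] z = rev-⌜⌝ r 2[1+ z ]
  rev-⌜⌝ 1+[2 r ] z = rev-⌜⌝ r 1+[2 z ]

  -- Moving an entry from one list to the other creates no vertex; only the terminal leaf of `r`
  -- disappears. So unwinding a stack never enlarges the store.
  size-rev : ∀ r z → suc (size (rev r z)) ≡ size r + size z
  size-rev leaf    z = refl
  size-rev (h ∙ r) z = trans (size-rev r (h ∙ z)) (rearrange (size h) (size r) (size z))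
    where
    rearrange : ∀ a b c → b + suc (a + c) ≡ suc (a + b) + c
    rearrange = solve-∀

  -- The number with low digits r, most significant digit first, and high part v.
  unwind : ℕᵇ → ℕ → ℕ
  unwind zero     v = v
  unwind 2[1+ r ] v = unwind r (2 + 2 * v)
  unwind 1+[2 r ] v = unwind r (1 + 2 * v)

  toℕ-revᵇ : ∀ r z → toℕ (revᵇ r z) ≡ unwind r (toℕ z)
  toℕ-revᵇ zero     z = refl
  toℕ-revᵇ 2[1+ r ] z = trans (toℕ-revᵇ r 2[1+ z ]) (cong (unwind r) (*-distribˡ-+ 2 1 (toℕ z)))
  toℕ-revᵇ 1+[2 r ] z = toℕ-revᵇ r 1+[2 z ]

  unwind-mono : ∀ r {v w} → v ≤ w → unwind r v ≤ unwind r w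
  unwind-mono zero     v≤w = v≤w
  unwind-mono 2[1+ r ] v≤w = unwind-mono r (+-monoʳ-≤ 2 (*-monoʳ-≤ 2 v≤w))
  unwind-mono 1+[2 r ] v≤w = unwind-mono r (+-monoʳ-≤ 1 (*-monoʳ-≤ 2 v≤w))

  ≤-unwind : ∀ r v → v ≤ unwind r v
  ≤-unwind zero     v = ≤-refl
  ≤-unwind 2[1+ r ] v = ≤-trans (≤-trans (m≤m+n v _) (m≤n+m _ 2)) (≤-unwind r (2 + 2 * v))
  ≤-unwind 1+[2 r ] v = ≤-trans (≤-trans (m≤m+n v _) (m≤n+m _ 1)) (≤-unwind r (1 + 2 * v))

  digit : ℕᵇ → ℕ
  digit zero     = 0
  digit 2[1+ _ ] = 2
  digit 1+[2 _ ] = 1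

  rest : ℕᵇ → ℕᵇ
  rest zero     = zero
  rest 2[1+ b ] = b
  rest 1+[2 b ] = b

  toℕ-digit : ∀ b → toℕ b ≡ digit b + 2 * toℕ (rest b)
  toℕ-digit zero     = refl
  toℕ-digit 2[1+ b ] = *-distribˡ-+ 2 1 (toℕ b)
  toℕ-digit 1+[2 b ] = refl

  digit≤2 : ∀ b → digit b ≤ 2
  digit≤2 zero     = z≤n
  digit≤2 2[1+ _ ] = ≤-refl
  digit≤2 1+[2 _ ] = s≤s z≤n

  digit≡0 : ∀ b → digit b ≡ 0 → b ≡ zero
  digit≡0 zero _ = refl

  halve-< : ∀ {a b} l → 2 * a + b < 2 ^ suc l → a < 2 ^ l
  halve-< {a} {b} l lt = *-cancelˡ-< 2 a (2 ^ l) (≤-<-trans (m≤m+n (2 * a) b) lt)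

  -- In bijective binary a number below `2 ^ l` has at most `l` digits. A digit contributes at most
  -- 4 to the size: digit 1 is a tree of size 3 below one further vertex. The last 1 is the terminal
  -- leaf.
  size-⌜⌝ : ∀ b l → toℕ b < 2 ^ l → size ⌜ b ⌝ ≤ 4 * l + 1
  size-⌜⌝ zero     l       _  = m≤n+m 1 (4 * l)
  size-⌜⌝ 2[1+ b ] zero    (s≤s ())
  size-⌜⌝ 1+[2 b ] zero    (s≤s ())
  size-⌜⌝ 2[1+ b ] (suc l) lt =
    ≤-trans (+-mono-≤ (m≤m+n 2 2) (size-⌜⌝ b l (halve-< l (subst (_< 2 ^ suc l) eq lt))))
            (≤-reflexive (rearrange l))
    where
    eq : toℕ 2[1+ b ] ≡ 2 * toℕ b + 2
    eq = trans (*-distribˡ-+ 2 1 (toℕ b)) (+-comm 2 (2 * toℕ b))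
    rearrange : ∀ l → 4 + (4 * l + 1) ≡ 4 * (1 + l) + 1
    rearrange = solve-∀
  size-⌜⌝ 1+[2 b ] (suc l) lt =
    ≤-trans (+-monoʳ-≤ 4 (size-⌜⌝ b l (halve-< l (subst (_< 2 ^ suc l) (+-comm 1 (2 * toℕ b)) lt))))
            (≤-reflexive (rearrange l))
    where
    rearrange : ∀ l → 4 + (4 * l + 1) ≡ 4 * (1 + l) + 1
    rearrange = solve-∀

  -- Converse estimate: it makes every numerator and denominator in an input of length `N` smaller
  -- than `2 ^ N`.
  toℕ<2^size : ∀ b → toℕ b < 2 ^ size ⌜ b ⌝
  toℕ<2^size zero     = s≤s z≤n
  toℕ<2^size 2[1+ b ] = begin-strict
    2 * suc (toℕ b)       ≤⟨ *-monoʳ-≤ 2 (toℕ<2^size b) ⟩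
    2 ^ suc (size ⌜ b ⌝)  <⟨ ^-monoʳ-< 2 (s≤s (s≤s z≤n)) {suc (size ⌜ b ⌝)} {2 + size ⌜ b ⌝} ≤-refl ⟩
    2 ^ (2 + size ⌜ b ⌝)  ∎
    where open ≤-Reasoning
  toℕ<2^size 1+[2 b ] = begin-strict
    suc (2 * toℕ b)       <⟨ n<1+n _ ⟩
    2 + 2 * toℕ b         ≡⟨ *-distribˡ-+ 2 1 (toℕ b) ⟨
    2 * suc (toℕ b)       ≤⟨ *-monoʳ-≤ 2 (toℕ<2^size b) ⟩
    2 ^ suc (size ⌜ b ⌝)  ≤⟨ ^-monoʳ-≤ 2 {suc (size ⌜ b ⌝)} {4 + size ⌜ b ⌝} (m≤n+m (suc (size ⌜ b ⌝)) 3) ⟩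
    2 ^ (4 + size ⌜ b ⌝)  ∎
    where open ≤-Reasoning

  -- Put the digit of n + 1 on a stack; ⌊ n /2⌋ is the carry.
  push : ℕ → ℕᵇ → ℕᵇ
  push 0             r = 1+[2 r ]
  push 1             r = 2[1+ r ]
  push (suc (suc n)) r = push n r

  -- The digits are 1 and 2, so a positive digit sum `suc n` splits as a digit in that range plus
  -- twice the carry, and that carry is `⌊ n /2⌋` rather than `⌊ suc n /2⌋`.
  unwind-push : ∀ n r w → unwind (push n r) (⌊ n /2⌋ + w) ≡ unwind r (suc n + 2 * w)
  unwind-push 0             r w = refl
  unwind-push 1             r w = refl
  unwind-push (suc (suc n)) r w =
    trans (cong (unwind (push n r)) (sym (+-suc ⌊ n /2⌋ w)))
   (trans (unwind-push n r (suc w)) (cong (unwind r) (rearrange n w)))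
    where
    rearrange : ∀ n w → suc n + 2 * suc w ≡ suc (suc (suc n)) + 2 * w
    rearrange = solve-∀

  -- The first eight variables: input and output, summands, carry, stack, result,
  -- flag, digit sum.

  unwindBody : Cmd 19
  unwindBody = 5F ≔ cons (hd (var 4F)) (var 5F) ⨾ 4F ≔ tl (var 4F)

  unwindCmd : Cmd 19
  unwindCmd = while var 4F loop unwindBody

  takeDigit : Fin 19 → Cmd 19
  takeDigit v =
    test var v
      yes (test hd (var v)
             yes (7F ≔ cons nil (var 7F))
             no  (7F ≔ cons nil (cons nil (var 7F)))
           ⨾ v ≔ tl (var v))
      no  skip

  reduce : Cmd 19
  reduce =
    test tl (tl (var 7F))
      yes (3F ≔ cons nil (var 3F) ⨾ 7F ≔ tl (tl (var 7F)))
      no  skip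

  sumDigits : Cmd 19
  sumDigits = 7F ≔ var 3F ⨾ (takeDigit 1F ⨾ (takeDigit 2F ⨾ 3F ≔ nil))

  -- A digit sum is at most 2 + 2 + 2 = 6, so two reductions by 2 leave digit 1 or 2. As no digit is
  -- 0, the digit sum is 0 exactly when both summands are exhausted and there is no carry; then the
  -- loop flag is cleared.
  emit : Cmd 19
  emit =
    test var 7F
      yes (reduce ⨾ (reduce ⨾
          (test tl (var 7F)
             yes (4F ≔ cons nil (var 4F))
             no  (4F ≔ cons (cons nil nil) (var 4F))
           ⨾ 7F ≔ nil)))
      no  (6F ≔ nil)

  addInit addBody addCmd : Cmd 19
  addInit = 3F ≔ nil ⨾ (4F ≔ nil ⨾ (5F ≔ nil ⨾ 6F ≔ cons nil nil))
  addBody = sumDigits ⨾ emit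
  addCmd  = addInit ⨾ ((while var 6F loop addBody) ⨾ unwindCmd)

  module _ {io z g s : Tree} {ρ : Store 11} where

    run-sumDigits : ∀ {r} x y c →
      run sumDigits (io ∷ ⌜ x ⌝ ∷ ⌜ y ⌝ ∷ unary c ∷ r ∷ z ∷ g ∷ s ∷ ρ) ≡
      io ∷ ⌜ rest x ⌝ ∷ ⌜ rest y ⌝ ∷ leaf ∷ r ∷ z ∷ g ∷ unary (digit y + (digit x + c)) ∷ ρ
    run-sumDigits zero     zero     zero    = refl
    run-sumDigits zero     zero     (suc c) = refl
    run-sumDigits zero     2[1+ y ] c = refl
    run-sumDigits zero     1+[2 y ] c = refl
    run-sumDigits 2[1+ x ] zero     c = refl
    run-sumDigits 2[1+ x ] 2[1+ y ] c = refl
    run-sumDigits 2[1+ x ] 1+[2 y ] c = refl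
    run-sumDigits 1+[2 x ] zero     c = refl
    run-sumDigits 1+[2 x ] 2[1+ y ] c = refl
    run-sumDigits 1+[2 x ] 1+[2 y ] c = refl

    run-emit : ∀ x y r n → n ≤ 5 →
      run emit (io ∷ x ∷ y ∷ leaf ∷ ⌜ r ⌝ ∷ z ∷ g ∷ unary (suc n) ∷ ρ) ≡
      io ∷ x ∷ y ∷ unary ⌊ n /2⌋ ∷ ⌜ push n r ⌝ ∷ z ∷ g ∷ leaf ∷ ρ
    run-emit x y r 0 _ = refl
    run-emit x y r 1 _ = refl
    run-emit x y r 2 _ = refl
    run-emit x y r 3 _ = refl
    run-emit x y r 4 _ = refl
    run-emit x y r 5 _ = refl
    run-emit x y r (suc (suc (suc (suc (suc (suc n)))))) (s≤s (s≤s (s≤s (s≤s (s≤s ())))))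

    run-addBody : ∀ x y c r n → digit y + (digit x + c) ≡ suc n → n ≤ 5 →
      run addBody (io ∷ ⌜ x ⌝ ∷ ⌜ y ⌝ ∷ unary c ∷ ⌜ r ⌝ ∷ z ∷ g ∷ s ∷ ρ) ≡
      io ∷ ⌜ rest x ⌝ ∷ ⌜ rest y ⌝ ∷ unary ⌊ n /2⌋ ∷ ⌜ push n r ⌝ ∷ z ∷ g ∷ leaf ∷ ρ
    run-addBody x y c r n eq n≤5 =
      trans (run-⨾ sumDigits emit (io ∷ ⌜ x ⌝ ∷ ⌜ y ⌝ ∷ unary c ∷ ⌜ r ⌝ ∷ z ∷ g ∷ s ∷ ρ))
            (subst (λ σ → run emit σ ≡ after) (sym summed) (run-emit ⌜ rest x ⌝ ⌜ rest y ⌝ r n n≤5))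
      where
      after : Store 19
      after = io ∷ ⌜ rest x ⌝ ∷ ⌜ rest y ⌝ ∷ unary ⌊ n /2⌋ ∷ ⌜ push n r ⌝ ∷ z ∷ g ∷ leaf ∷ ρ
      summed : run sumDigits (io ∷ ⌜ x ⌝ ∷ ⌜ y ⌝ ∷ unary c ∷ ⌜ r ⌝ ∷ z ∷ g ∷ s ∷ ρ) ≡
               io ∷ ⌜ rest x ⌝ ∷ ⌜ rest y ⌝ ∷ leaf ∷ ⌜ r ⌝ ∷ z ∷ g ∷ unary (suc n) ∷ ρ
      summed = subst (λ d → run sumDigits (io ∷ ⌜ x ⌝ ∷ ⌜ y ⌝ ∷ unary c ∷ ⌜ r ⌝ ∷ z ∷ g ∷ s ∷ ρ) ≡
                            io ∷ ⌜ rest x ⌝ ∷ ⌜ rest y ⌝ ∷ leaf ∷ ⌜ r ⌝ ∷ z ∷ g ∷ unary d ∷ ρ)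
                     eq (run-sumDigits x y c)

  digitSum≤ : ∀ x y {c} → c ≤ 2 → digit y + (digit x + c) ≤ 6
  digitSum≤ x y c≤2 = +-mono-≤ (digit≤2 y) (+-mono-≤ (digit≤2 x) c≤2)

  total : ℕᵇ → ℕᵇ → ℕ → ℕ
  total x y c = toℕ x + toℕ y + c

  total-digits : ∀ x y c → total x y c ≡
    digit y + (digit x + c) + 2 * (toℕ (rest x) + toℕ (rest y))
  total-digits x y c rewrite toℕ-digit x | toℕ-digit y =
    rearrange (digit x) (digit y) c (toℕ (rest x)) (toℕ (rest y))
    where
    rearrange : ∀ a b c u v → a + 2 * u + (b + 2 * v) + c ≡ b + (a + c) + 2 * (u + v)
    rearrange = solve-∀

  2*⌊n/2⌋≤n : ∀ n → 2 * ⌊ n /2⌋ ≤ n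
  2*⌊n/2⌋≤n 0             = z≤n
  2*⌊n/2⌋≤n 1             = z≤n
  2*⌊n/2⌋≤n (suc (suc n)) =
    ≤-trans (≤-reflexive (*-distribˡ-+ 2 1 ⌊ n /2⌋)) (+-monoʳ-≤ 2 (2*⌊n/2⌋≤n n))

  size-unary : ∀ {n} → n ≤ 2 → size (unary n) ≤ 5
  size-unary {0} _ = s≤s z≤n
  size-unary {1} _ = s≤s (s≤s (s≤s z≤n))
  size-unary {2} _ = ≤-refl
  size-unary {suc (suc (suc n))} (s≤s (s≤s ()))

  module Addition (L B : ℕ) (4L+5≤B : 4 * L + 5 ≤ B) where

    5≤B : 5 ≤ B
    5≤B = ≤-trans (m≤n+m 5 (4 * L)) 4L+5≤B

    1≤B : 1 ≤ B
    1≤B = ≤-trans (s≤s z≤n) 5≤B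

    ⌜⌝≤B : ∀ b → toℕ b < 2 ^ L → size ⌜ b ⌝ ≤ B
    ⌜⌝≤B b lt = ≤-trans (size-⌜⌝ b L lt) (≤-trans (+-monoʳ-≤ (4 * L) (s≤s z≤n)) 4L+5≤B)

    -- The stack and the high part together are as large as the finished number plus one leaf, by
    -- `size-rev`. Hence a bound on the final value bounds all intermediate stacks.
    stack≤B : ∀ r z → unwind r (toℕ z) < 2 ^ L → size ⌜ r ⌝ + size ⌜ z ⌝ ≤ suc B
    stack≤B r z lt = subst (_≤ suc B)
      (trans (cong (suc ∘′ size) (sym (rev-⌜⌝ r z))) (size-rev ⌜ r ⌝ ⌜ z ⌝))
      (s≤s (⌜⌝≤B (revᵇ r z) (subst (_< 2 ^ L) (sym (toℕ-revᵇ r z)) lt)))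

    stack≤B₀ : ∀ r w → unwind r w < 2 ^ L → size ⌜ r ⌝ ≤ B
    stack≤B₀ r w lt = s≤s⁻¹ (subst (_≤ suc B) (+-comm _ 1)
      (stack≤B r zero (≤-<-trans (unwind-mono r z≤n) lt)))

    unwindTime : ℕ → ℕ
    unwindTime = loopTime B (straightTime unwindBody B)

    exec-unwind : ∀ {io x y c g s} {ρ : Store 11} n r z → size r ≤ n → size r + size z ≤ suc B →
      Bounded B (io ∷ x ∷ y ∷ c ∷ []) → Bounded B (g ∷ s ∷ ρ) →
      Exec unwindCmd (io ∷ x ∷ y ∷ c ∷ r ∷ z ∷ g ∷ s ∷ ρ)
                     (io ∷ x ∷ y ∷ c ∷ leaf ∷ rev r z ∷ g ∷ s ∷ ρ) (unwindTime n)
    exec-unwind n leaf z _ le (bio ∷ bx ∷ by ∷ bc ∷ []) bs =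
      loop-done 1≤B (bio ∷ bx ∷ by ∷ bc ∷ 1≤B ∷ s≤s⁻¹ le ∷ bs) refl
    exec-unwind (suc n) (h ∙ r) z (s≤s r≤n) le (bio ∷ bx ∷ by ∷ bc ∷ []) bs =
      loop-step 1≤B bounded refl (exec-run unwindBody 1≤B bounded refl)
        (exec-unwind n r (h ∙ z) (≤-trans (m≤n+m _ (size h)) r≤n)
          (≤-trans (≤-reflexive (rearrange (size h) (size r) (size z))) le)
          (bio ∷ bx ∷ by ∷ bc ∷ []) bs)
      where
      rearrange : ∀ a b c → b + suc (a + c) ≡ suc (a + b) + c
      rearrange = solve-∀
      bounded : Bounded B _
      bounded = bio ∷ bx ∷ by ∷ bc
        ∷ s≤s⁻¹ (≤-trans (≤-trans (≤-reflexive (+-comm 1 _)) (+-monoʳ-≤ (size (h ∙ r)) (size>0 z))) le)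
        ∷ s≤s⁻¹ (≤-trans (+-monoˡ-≤ (size z) (s≤s z≤n)) le) ∷ bs

    addLoopTime addTime : ℕ
    -- At most one round per digit of the result, and a last round that finds digit sum 0.
    addLoopTime = loopTime B (straightTime addBody B) (suc L)
    addTime     = straightTime addInit B + (addLoopTime + unwindTime B)

    -- The invariant is `unwind r (total x y c)`, the final sum: digits on the stack are settled,
    -- the rest is still to be added. Each round more than halves `total`, so `l` drops by one.
    exec-addLoop : ∀ {io z s} {ρ : Store 11} l x y c r → c ≤ 2 → total x y c < 2 ^ l →
      unwind r (total x y c) < 2 ^ L →
      size io ≤ B → size z ≤ B → size s ≤ B → Bounded B ρ →
      ∃[ r′ ] unwind r′ 0 ≡ unwind r (total x y c) ×
        Exec (while var 6F loop addBody)
          (io ∷ ⌜ x ⌝ ∷ ⌜ y ⌝ ∷ unary c ∷ ⌜ r ⌝ ∷ z ∷ unary 1 ∷ s ∷ ρ)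
          (io ∷ leaf ∷ leaf ∷ leaf ∷ ⌜ r′ ⌝ ∷ z ∷ leaf ∷ leaf ∷ ρ)
          (loopTime B (straightTime addBody B) (suc l))
    exec-addLoop {io = io} {z} {s} {ρ} l x y c r c≤2 <2^l <2^L bio bz bs bρ =
      go (digit y + (digit x + c)) refl
      where
      bounded : Bounded B (io ∷ ⌜ x ⌝ ∷ ⌜ y ⌝ ∷ unary c ∷ ⌜ r ⌝ ∷ z ∷ unary 1 ∷ s ∷ ρ)
      bounded = bio
        ∷ ⌜⌝≤B x (≤-<-trans (≤-trans (≤-trans (m≤m+n _ (toℕ y)) (m≤m+n _ c)) (≤-unwind r _)) <2^L)
        ∷ ⌜⌝≤B y (≤-<-trans (≤-trans (≤-trans (m≤n+m _ (toℕ x)) (m≤m+n _ c)) (≤-unwind r _)) <2^L)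
        ∷ ≤-trans (size-unary c≤2) 5≤B ∷ stack≤B₀ r _ <2^L ∷ bz
        ∷ ≤-trans (s≤s (s≤s (s≤s z≤n))) 5≤B ∷ bs ∷ bρ

      go : ∀ d → digit y + (digit x + c) ≡ d → ∃[ r′ ] unwind r′ 0 ≡ unwind r (total x y c) ×
        Exec (while var 6F loop addBody)
          (io ∷ ⌜ x ⌝ ∷ ⌜ y ⌝ ∷ unary c ∷ ⌜ r ⌝ ∷ z ∷ unary 1 ∷ s ∷ ρ)
          (io ∷ leaf ∷ leaf ∷ leaf ∷ ⌜ r′ ⌝ ∷ z ∷ leaf ∷ leaf ∷ ρ)
          (loopTime B (straightTime addBody B) (suc l))
      go zero eq with digit≡0 x (m+n≡0⇒m≡0 _ (m+n≡0⇒n≡0 (digit y) eq))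
                    | digit≡0 y (m+n≡0⇒m≡0 _ eq) | m+n≡0⇒n≡0 (digit x) (m+n≡0⇒n≡0 (digit y) eq)
      ... | refl | refl | refl = r , refl ,
        loop-step {T = straightTime addBody B} 1≤B bounded refl (exec-run addBody 1≤B bounded refl)
          (loop-done 1≤B (bio ∷ 1≤B ∷ 1≤B ∷ 1≤B ∷ stack≤B₀ r _ <2^L ∷ bz ∷ 1≤B ∷ 1≤B ∷ bρ) refl)
      go (suc n) eq = next l <2^l
        where
        w  = toℕ (rest x) + toℕ (rest y)
        eqT : total x y c ≡ suc n + 2 * w
        eqT = trans (total-digits x y c) (cong (_+ 2 * w) eq)
        eqU : unwind (push n r) (total (rest x) (rest y) ⌊ n /2⌋) ≡ unwind r (total x y c)
        eqU = trans (cong (unwind (push n r)) (+-comm w ⌊ n /2⌋))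
             (trans (unwind-push n r w) (cong (unwind r) (sym eqT)))
        n≤5 : n ≤ 5
        n≤5 = s≤s⁻¹ (subst (_≤ 6) eq (digitSum≤ x y c≤2))
        halved : 2 * total (rest x) (rest y) ⌊ n /2⌋ < total x y c
        halved = begin-strict
          2 * (w + ⌊ n /2⌋)      ≡⟨ *-distribˡ-+ 2 w ⌊ n /2⌋ ⟩
          2 * w + 2 * ⌊ n /2⌋    ≤⟨ +-monoʳ-≤ (2 * w) (2*⌊n/2⌋≤n n) ⟩
          2 * w + n              <⟨ n<1+n _ ⟩
          suc (2 * w + n)        ≡⟨ cong suc (+-comm (2 * w) n) ⟩
          suc n + 2 * w          ≡⟨ eqT ⟨
          total x y c            ∎
          where open ≤-Reasoning
        body : Exec addBody
          (io ∷ ⌜ x ⌝ ∷ ⌜ y ⌝ ∷ unary c ∷ ⌜ r ⌝ ∷ z ∷ unary 1 ∷ s ∷ ρ)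
          (io ∷ ⌜ rest x ⌝ ∷ ⌜ rest y ⌝ ∷ unary ⌊ n /2⌋ ∷ ⌜ push n r ⌝ ∷ z ∷ unary 1 ∷ leaf ∷ ρ)
          (straightTime addBody B)
        body = exec-run addBody 1≤B bounded (run-addBody {io} {z} {unary 1} {s} {ρ} x y c r n eq n≤5)
        next : ∀ l → total x y c < 2 ^ l → ∃[ r′ ] unwind r′ 0 ≡ unwind r (total x y c) ×
          Exec (while var 6F loop addBody)
            (io ∷ ⌜ x ⌝ ∷ ⌜ y ⌝ ∷ unary c ∷ ⌜ r ⌝ ∷ z ∷ unary 1 ∷ s ∷ ρ)
            (io ∷ leaf ∷ leaf ∷ leaf ∷ ⌜ r′ ⌝ ∷ z ∷ leaf ∷ leaf ∷ ρ)
            (loopTime B (straightTime addBody B) (suc l))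
        -- A positive digit sum makes the total positive, against `total x y c < 2 ^ 0`.
        next zero    lt with () ← ≤-trans (subst (0 <_) (sym eqT) (s≤s z≤n)) (s≤s⁻¹ lt)
        next (suc l) lt with exec-addLoop {s = leaf} l (rest x) (rest y) ⌊ n /2⌋ (push n r)
                               (⌊n/2⌋-mono n≤5)
                               (*-cancelˡ-< 2 _ _ (<-trans halved lt))
                               (subst (_< 2 ^ L) (sym eqU) <2^L) bio bz 1≤B bρ
        ... | r′ , eq′ , ex = r′ , trans eq′ eqU , loop-step 1≤B bounded refl body ex

    exec-add : ∀ {io c r z g s} {ρ : Store 11} x y → toℕ x + toℕ y < 2 ^ L →
      Bounded B (io ∷ ⌜ x ⌝ ∷ ⌜ y ⌝ ∷ c ∷ r ∷ z ∷ g ∷ s ∷ ρ) →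
      Exec addCmd (io ∷ ⌜ x ⌝ ∷ ⌜ y ⌝ ∷ c ∷ r ∷ z ∷ g ∷ s ∷ ρ)
                  (io ∷ leaf ∷ leaf ∷ leaf ∷ leaf ∷ ⌜ x ℕᵇ.+ y ⌝ ∷ leaf ∷ leaf ∷ ρ) addTime
    exec-add {io = io} {s = s} {ρ} x y lt bounded@(bio ∷ _ ∷ _ ∷ _ ∷ _ ∷ _ ∷ _ ∷ bs ∷ bρ)
      with exec-addLoop L x y 0 zero z≤n (subst (_< 2 ^ L) (sym (+-identityʳ _)) lt)
             (subst (_< 2 ^ L) (sym (+-identityʳ _)) lt) bio 1≤B bs bρ
    ... | r′ , eq , ex =
      exec-run {ρ′ = io ∷ ⌜ x ⌝ ∷ ⌜ y ⌝ ∷ leaf ∷ leaf ∷ leaf ∷ unary 1 ∷ s ∷ ρ} addInit 1≤B bounded refl ⟫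
      ex ⟫
      subst (λ t → Exec unwindCmd (io ∷ leaf ∷ leaf ∷ leaf ∷ ⌜ r′ ⌝ ∷ leaf ∷ leaf ∷ leaf ∷ ρ)
                                  (io ∷ leaf ∷ leaf ∷ leaf ∷ leaf ∷ t ∷ leaf ∷ leaf ∷ ρ) (unwindTime B))
        (trans (rev-⌜⌝ r′ zero) (cong ⌜_⌝ sum≡))
        (exec-unwind B ⌜ r′ ⌝ leaf (stack≤B₀ r′ 0 <2^L) (stack≤B r′ zero <2^L)
          (bio ∷ 1≤B ∷ 1≤B ∷ 1≤B ∷ []) (1≤B ∷ 1≤B ∷ bρ))
      where
      eq₀ : unwind r′ 0 ≡ toℕ x + toℕ y
      eq₀ = trans eq (+-identityʳ _)
      <2^L : unwind r′ 0 < 2 ^ L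
      <2^L = subst (_< 2 ^ L) (sym eq₀) lt
      sum≡ : revᵇ r′ zero ≡ x ℕᵇ.+ y
      sum≡ = ℕᵇ.toℕ-injective (trans (toℕ-revᵇ r′ zero) (trans eq₀ (sym (ℕᵇ.toℕ-homo-+ x y))))

  -- Binary multiplication

  pattern 10F = suc 9F
  pattern 11F = suc 10F

  -- Variables 8 to 11: multiplicand, multiplier, high part and low digits of the
  -- product.

  loadOperands storeSum addOperand : Cmd 19
  loadOperands = 1F ≔ var 8F ⨾ 2F ≔ var 10F
  storeSum = 10F ≔ var 5F ⨾ 5F ≔ nil
  addOperand = loadOperands ⨾ addCmd ⨾ storeSum

  shift : Cmd 19
  shift = 11F ≔ cons (hd (var 10F)) (var 11F) ⨾ 10F ≔ tl (var 10F) ⨾ 9F ≔ tl (var 9F)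

  -- Schoolbook multiplication from the least significant digit: the multiplicand is added once for
  -- digit 1 and twice for digit 2. The lowest digit of the high part is then final and moves to the
  -- stack.
  mulBody : Cmd 19
  mulBody = (test hd (var 9F) yes addOperand no (addOperand ⨾ addOperand)) ⨾ shift

  loadProduct clearProduct mulCmd : Cmd 19
  loadProduct = 4F ≔ var 11F ⨾ 5F ≔ var 10F
  clearProduct = 10F ≔ nil ⨾ 11F ≔ nil
  mulCmd = (while var 9F loop mulBody) ⨾ loadProduct ⨾ unwindCmd
         ⨾ clearProduct

  mulState : Tree → (a b p q : ℕᵇ) → Store 7 → Store 19
  mulState io a b p q ρ =
    io ∷ leaf ∷ leaf ∷ leaf ∷ leaf ∷ leaf ∷ leaf ∷ leaf ∷ ⌜ a ⌝ ∷ ⌜ b ⌝ ∷ ⌜ p ⌝ ∷ ⌜ q ⌝ ∷ ρ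

  pushLow : ℕᵇ → ℕᵇ → ℕᵇ
  pushLow zero     q = q
  pushLow 2[1+ _ ] q = 2[1+ q ]
  pushLow 1+[2 _ ] q = 1+[2 q ]

  run-shift : ∀ io a b p q ρ → 0 < toℕ p →
    run shift (mulState io a b p q ρ) ≡ mulState io a (rest b) (rest p) (pushLow p q) ρ
  run-shift io a zero     2[1+ p ] q ρ _ = refl
  run-shift io a 2[1+ b ] 2[1+ p ] q ρ _ = refl
  run-shift io a 1+[2 b ] 2[1+ p ] q ρ _ = refl
  run-shift io a zero     1+[2 p ] q ρ _ = refl
  run-shift io a 2[1+ b ] 1+[2 p ] q ρ _ = refl
  run-shift io a 1+[2 b ] 1+[2 p ] q ρ _ = refl

  -- A bijective numeral has a nonzero digit at each position, so a zero high part would have no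
  -- digit to push. Positivity of the multiplicand rules this out in the loop.
  unwind-pushLow : ∀ p q v → 0 < toℕ p →
    unwind (pushLow p q) (toℕ (rest p) + v) ≡ unwind q (toℕ p + 2 * v)
  unwind-pushLow 2[1+ p ] q v _ = cong (unwind q) (rearrange (toℕ p) v)
    where
    rearrange : ∀ p v → 2 + 2 * (p + v) ≡ 2 * suc p + 2 * v
    rearrange = solve-∀
  unwind-pushLow 1+[2 p ] q v _ = cong (unwind q) (rearrange (toℕ p) v)
    where
    rearrange : ∀ p v → 1 + 2 * (p + v) ≡ suc (2 * p) + 2 * v
    rearrange = solve-∀

  -- Binary comparison

  cmpBody : Cmd 19
  cmpBody =
    (test var 2F
       yes (test hd (var 1F)
              yes (test hd (var 2F) yes skip no (3F ≔ nil))
              no  (test hd (var 2F) yes (3F ≔ cons nil nil) no skip))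
       no  (3F ≔ cons nil nil))
    ⨾ 1F ≔ tl (var 1F) ⨾ 2F ≔ tl (var 2F)

  -- Digits of the second number left after the first has ended make the first smaller, whatever the
  -- lower digits said.
  cmpEnd : Cmd 19
  cmpEnd = test var 2F yes (3F ≔ nil ⨾ 2F ≔ nil) no skip

  cmpCmd : Cmd 19
  cmpCmd = (while var 1F loop cmpBody) ⨾ cmpEnd

  flag : Bool → Tree
  flag false = leaf
  flag true  = leaf ∙ leaf

  -- Whether x exceeds y, ties being decided by the outcome on the lower digits.
  exceeds : ℕᵇ → ℕᵇ → Bool → Bool
  exceeds zero     zero     c = c
  exceeds zero     2[1+ _ ] c = false
  exceeds zero     1+[2 _ ] c = false
  exceeds 2[1+ x ] zero     c = exceeds x zero true
  exceeds 2[1+ x ] 2[1+ y ] c = exceeds x y c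
  exceeds 2[1+ x ] 1+[2 y ] c = exceeds x y true
  exceeds 1+[2 x ] zero     c = exceeds x zero true
  exceeds 1+[2 x ] 2[1+ y ] c = exceeds x y false
  exceeds 1+[2 x ] 1+[2 y ] c = exceeds x y c

  -- A comparison with a parameter `c` for ties, so that results on low and high digits compose
  -- lexicographically.
  data Outcome (m n : ℕ) (c : Bool) : Bool → Set where
    less    : m < n → Outcome m n c false
    greater : n < m → Outcome m n c true
    equal   : m ≡ n → Outcome m n c c

  -- Digits lie between 1 and 2 and so differ by less than the base: the higher parts decide unless
  -- they are equal.
  digits-< : ∀ {d e m n} → d ≤ 2 → 1 ≤ e → m < n → d + 2 * m < e + 2 * n
  digits-< {d} {e} {m} {n} d≤2 1≤e m<n = begin-strict
    d + 2 * m    ≤⟨ +-monoˡ-≤ (2 * m) d≤2 ⟩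
    2 + 2 * m    ≡⟨ *-distribˡ-+ 2 1 m ⟨
    2 * suc m    ≤⟨ *-monoʳ-≤ 2 m<n ⟩
    2 * n        <⟨ +-monoˡ-≤ (2 * n) 1≤e ⟩
    e + 2 * n    ∎
    where open ≤-Reasoning

  outcome-digits : ∀ {m n c c′ r} d e → d ≤ 2 → e ≤ 2 → 1 ≤ d → 1 ≤ e →
    Outcome d e c c′ → Outcome m n c′ r → Outcome (d + 2 * m) (e + 2 * n) c r
  outcome-digits d e d≤2 e≤2 1≤d 1≤e _           (less m<n)    = less (digits-< d≤2 1≤e m<n)
  outcome-digits d e d≤2 e≤2 1≤d 1≤e _           (greater n<m) = greater (digits-< e≤2 1≤d n<m)
  outcome-digits {m} d e _ _ _ _ (less d<e)    (equal refl) = less (+-monoˡ-< (2 * m) d<e)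
  outcome-digits {m} d e _ _ _ _ (greater e<d) (equal refl) = greater (+-monoˡ-< (2 * m) e<d)
  outcome-digits d e _ _ _ _ (equal refl)  (equal refl) = equal refl

  exceeds-outcome : ∀ x y c → Outcome (toℕ x) (toℕ y) c (exceeds x y c)
  exceeds-outcome zero     zero     c = equal refl
  exceeds-outcome zero     2[1+ y ] c = less (s≤s z≤n)
  exceeds-outcome zero     1+[2 y ] c = less (s≤s z≤n)
  exceeds-outcome 2[1+ x ] zero     c with exceeds x zero true | exceeds-outcome x zero true
  ... | _ | greater _ = greater (s≤s z≤n)
  ... | _ | equal _   = greater (s≤s z≤n)
  exceeds-outcome 1+[2 x ] zero     c with exceeds x zero true | exceeds-outcome x zero true
  ... | _ | greater _ = greater (s≤s z≤n)
  ... | _ | equal _   = greater (s≤s z≤n)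
  exceeds-outcome 2[1+ x ] 2[1+ y ] c rewrite *-distribˡ-+ 2 1 (toℕ x) | *-distribˡ-+ 2 1 (toℕ y) =
    outcome-digits 2 2 ≤-refl ≤-refl (s≤s z≤n) (s≤s z≤n) (equal refl) (exceeds-outcome x y c)
  exceeds-outcome 2[1+ x ] 1+[2 y ] c rewrite *-distribˡ-+ 2 1 (toℕ x) =
    outcome-digits 2 1 ≤-refl (s≤s z≤n) (s≤s z≤n) (s≤s z≤n) (greater ≤-refl) (exceeds-outcome x y true)
  exceeds-outcome 1+[2 x ] 2[1+ y ] c rewrite *-distribˡ-+ 2 1 (toℕ y) =
    outcome-digits 1 2 (s≤s z≤n) ≤-refl (s≤s z≤n) (s≤s z≤n) (less ≤-refl) (exceeds-outcome x y false)
  exceeds-outcome 1+[2 x ] 1+[2 y ] c =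
    outcome-digits 1 1 (s≤s z≤n) (s≤s z≤n) (s≤s z≤n) (s≤s z≤n) (equal refl) (exceeds-outcome x y c)

  outcome-≤ : ∀ {m n c r} → Outcome m n c r → r ≡ false → m ≤ n
  outcome-≤ (less m<n)    _ = <⇒≤ m<n
  outcome-≤ (equal m≡n)   _ = ≤-reflexive m≡n

  outcome-≥ : ∀ {m n c r} → Outcome m n c r → r ≡ true → n ≤ m
  outcome-≥ (greater n<m) _ = <⇒≤ n<m
  outcome-≥ (equal m≡n)   _ = ≤-reflexive (sym m≡n)

  run-cmpBody : ∀ {io} {ρ : Store 15} x y c → 0 < toℕ x → ∃[ c′ ]
    exceeds x y c ≡ exceeds (rest x) (rest y) c′ ×
    run cmpBody (io ∷ ⌜ x ⌝ ∷ ⌜ y ⌝ ∷ flag c ∷ ρ) ≡ io ∷ ⌜ rest x ⌝ ∷ ⌜ rest y ⌝ ∷ flag c′ ∷ ρ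
  run-cmpBody 2[1+ x ] zero     c _ = true  , refl , refl
  run-cmpBody 2[1+ x ] 2[1+ y ] c _ = c     , refl , refl
  run-cmpBody 2[1+ x ] 1+[2 y ] c _ = true  , refl , refl
  run-cmpBody 1+[2 x ] zero     c _ = true  , refl , refl
  run-cmpBody 1+[2 x ] 2[1+ y ] c _ = false , refl , refl
  run-cmpBody 1+[2 x ] 1+[2 y ] c _ = c     , refl , refl

  run-cmpEnd : ∀ {io} {ρ : Store 15} y c →
    run cmpEnd (io ∷ leaf ∷ ⌜ y ⌝ ∷ flag c ∷ ρ) ≡ io ∷ leaf ∷ leaf ∷ flag (exceeds zero y c) ∷ ρ
  run-cmpEnd zero     c = refl
  run-cmpEnd 2[1+ y ] c = refl
  run-cmpEnd 1+[2 y ] c = refl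

  size-rest : ∀ b → size ⌜ rest b ⌝ ≤ size ⌜ b ⌝
  size-rest zero     = ≤-refl
  size-rest 2[1+ b ] = m≤n+m _ 2
  size-rest 1+[2 b ] = m≤n+m _ 4

  size-rest-< : ∀ b → 0 < toℕ b → size ⌜ rest b ⌝ < size ⌜ b ⌝
  size-rest-< 2[1+ b ] _ = m≤n+m _ 1
  size-rest-< 1+[2 b ] _ = m≤n+m _ 3

  nonleaf : ∀ b → 0 < toℕ b → ∃[ t ] ∃[ u ] ⌜ b ⌝ ≡ t ∙ u
  nonleaf 2[1+ b ] _ = _ , _ , refl
  nonleaf 1+[2 b ] _ = _ , _ , refl

  -- Executions of multiplication and comparison

  module Multiplication (L B : ℕ) (4L+5≤B : 4 * L + 5 ≤ B) where
    open Addition L B 4L+5≤B public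

    addOperandTime : ℕ
    addOperandTime = straightTime loadOperands B
      + (addTime + straightTime storeSum B)

    exec-addOperand : ∀ {io ρ} a b p q → toℕ a + toℕ p < 2 ^ L →
      size io ≤ B → size ⌜ b ⌝ ≤ B → size ⌜ q ⌝ ≤ B → Bounded B ρ →
      Exec addOperand (mulState io a b p q ρ) (mulState io a b (a ℕᵇ.+ p) q ρ) addOperandTime
    exec-addOperand {io} {ρ} a b p q lt bio bb bq bρ =
      exec-run {ρ = mulState io a b p q ρ} {ρ′ = s₁} loadOperands 1≤B
        (bio ∷ 1≤B ∷ 1≤B ∷ 1≤B ∷ 1≤B ∷ 1≤B ∷ 1≤B ∷ 1≤B ∷ ba ∷ bb ∷ bp ∷ bq ∷ bρ) refl
      ⟫ exec-add {io} {leaf} {leaf} {leaf} {leaf} {leaf} {⌜ a ⌝ ∷ ⌜ b ⌝ ∷ ⌜ p ⌝ ∷ ⌜ q ⌝ ∷ ρ} a p lt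
          (bio ∷ ba ∷ bp ∷ 1≤B ∷ 1≤B ∷ 1≤B ∷ 1≤B ∷ 1≤B ∷ ba ∷ bb ∷ bp ∷ bq ∷ bρ)
      ⟫ exec-run {ρ = s₂} {ρ′ = mulState io a b (a ℕᵇ.+ p) q ρ} storeSum 1≤B
          (bio ∷ 1≤B ∷ 1≤B ∷ 1≤B ∷ 1≤B ∷ bs ∷ 1≤B ∷ 1≤B ∷ ba ∷ bb ∷ bp ∷ bq ∷ bρ) refl
      where
      s₁ s₂ : Store 19
      s₁ = io ∷ ⌜ a ⌝ ∷ ⌜ p ⌝ ∷ leaf ∷ leaf ∷ leaf ∷ leaf ∷ leaf ∷ ⌜ a ⌝ ∷ ⌜ b ⌝ ∷ ⌜ p ⌝ ∷ ⌜ q ⌝ ∷ ρ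
      s₂ = io ∷ leaf ∷ leaf ∷ leaf ∷ leaf ∷ ⌜ a ℕᵇ.+ p ⌝ ∷ leaf ∷ leaf ∷ ⌜ a ⌝ ∷ ⌜ b ⌝ ∷ ⌜ p ⌝ ∷ ⌜ q ⌝ ∷ ρ
      ba = ⌜⌝≤B a (≤-<-trans (m≤m+n _ _) lt)
      bp = ⌜⌝≤B p (≤-<-trans (m≤n+m _ _) lt)
      bs = ⌜⌝≤B (a ℕᵇ.+ p) (subst (_< 2 ^ L) (sym (ℕᵇ.toℕ-homo-+ a p)) lt)

    mulBodyTime mulLoopTime mulTime : ℕ
    -- The test expression `hd (var 9F)` has two nodes, and a third `B` covers the unit cost of the
    -- test itself.
    mulBodyTime = 3 * B + (addOperandTime + addOperandTime) + straightTime shift B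
    mulLoopTime = loopTime B mulBodyTime B
    mulTime     = mulLoopTime + (straightTime loadProduct B
                + (unwindTime B + straightTime clearProduct B))

    exec-addMultiple : ∀ {io ρ} a b p q → 0 < toℕ b → toℕ p + digit b * toℕ a < 2 ^ L → size ⌜ a ⌝ ≤ B →
      size io ≤ B → size ⌜ b ⌝ ≤ B → size ⌜ q ⌝ ≤ B → Bounded B ρ → ∃[ p′ ]
      toℕ p′ ≡ toℕ p + digit b * toℕ a ×
      Exec (test hd (var 9F) yes addOperand no (addOperand ⨾ addOperand))
           (mulState io a b p q ρ) (mulState io a b p′ q ρ) (3 * B + (addOperandTime + addOperandTime))
    exec-addMultiple {io} {ρ} a b@(1+[2 _ ]) p q _ lt ba bio bb bq bρ =
      a ℕᵇ.+ p , eq ,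
      weaken (+-monoʳ-≤ (3 * B) (m≤m+n addOperandTime _))
        (exec-yes 1≤B (bio ∷ 1≤B ∷ 1≤B ∷ 1≤B ∷ 1≤B ∷ 1≤B ∷ 1≤B ∷ 1≤B ∷ ba ∷ bb ∷ bp ∷ bq ∷ bρ) refl
          (exec-addOperand a b p q lt′ bio bb bq bρ))
      where
      bp = ⌜⌝≤B p (≤-<-trans (m≤m+n _ _) lt)
      comm : ∀ a p → a + p ≡ p + (a + 0)
      comm = solve-∀
      eq  = trans (ℕᵇ.toℕ-homo-+ a p) (comm (toℕ a) (toℕ p))
      lt′ = subst (_< 2 ^ L) (sym (comm (toℕ a) (toℕ p))) lt
    exec-addMultiple {io} {ρ} a b@(2[1+ _ ]) p q _ lt ba bio bb bq bρ =
      a ℕᵇ.+ (a ℕᵇ.+ p) , eq ,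
      exec-no 1≤B (bio ∷ 1≤B ∷ 1≤B ∷ 1≤B ∷ 1≤B ∷ 1≤B ∷ 1≤B ∷ 1≤B ∷ ba ∷ bb ∷ bp ∷ bq ∷ bρ) refl
        (exec-addOperand a b p q (≤-<-trans (m≤n+m _ (toℕ a)) lt₂) bio bb bq bρ
         ⟫ exec-addOperand a b (a ℕᵇ.+ p) q
             (subst (λ n → toℕ a + n < 2 ^ L) (sym (ℕᵇ.toℕ-homo-+ a p)) lt₂) bio bb bq bρ)
      where
      bp = ⌜⌝≤B p (≤-<-trans (m≤m+n _ _) lt)
      comm : ∀ a p → a + (a + p) ≡ p + (a + (a + 0))
      comm = solve-∀
      eq  = trans (ℕᵇ.toℕ-homo-+ a (a ℕᵇ.+ p))
           (trans (cong (toℕ a +_) (ℕᵇ.toℕ-homo-+ a p)) (comm (toℕ a) (toℕ p)))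
      lt₂ : toℕ a + (toℕ a + toℕ p) < 2 ^ L
      lt₂ = subst (_< 2 ^ L) (sym (comm (toℕ a) (toℕ p))) lt

    -- The invariant `unwind q (p + a * b)` is the final product: the digits in `q` are settled, and
    -- the high part `p` still lacks `a` times the remaining multiplier.
    MulLoop : Tree → Store 7 → ℕ → (a b p q : ℕᵇ) → Set
    MulLoop io ρ n a b p q = ∃[ p′ ] ∃[ q′ ]
      unwind q′ (toℕ p′) ≡ unwind q (toℕ p + toℕ a * toℕ b) ×
      Exec (while var 9F loop mulBody)
        (mulState io a b p q ρ) (mulState io a zero p′ q′ ρ) (loopTime B mulBodyTime n)

    module _ {io : Tree} {ρ : Store 7} (bio : size io ≤ B) (bρ : Bounded B ρ)
             (a : ℕᵇ) (0<a : 0 < toℕ a) (ba : size ⌜ a ⌝ ≤ B) where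

      private
        0<digit : ∀ b → 0 < toℕ b → 0 < digit b
        0<digit 2[1+ _ ] _ = s≤s z≤n
        0<digit 1+[2 _ ] _ = s≤s z≤n

        bounded : ∀ b p q → size ⌜ b ⌝ ≤ B → unwind q (toℕ p + toℕ a * toℕ b) < 2 ^ L →
                  Bounded B (mulState io a b p q ρ)
        bounded b p q bb lt = bio ∷ 1≤B ∷ 1≤B ∷ 1≤B ∷ 1≤B ∷ 1≤B ∷ 1≤B ∷ 1≤B ∷ ba ∷ bb
          ∷ ⌜⌝≤B p (≤-<-trans (≤-trans (m≤m+n _ _) (≤-unwind q _)) lt) ∷ stack≤B₀ q _ lt ∷ bρ

      exec-mulLoop : ∀ n b p q → size ⌜ b ⌝ ≤ n → size ⌜ b ⌝ ≤ B →
        unwind q (toℕ p + toℕ a * toℕ b) < 2 ^ L → MulLoop io ρ n a b p q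
      exec-mulStep : ∀ n b p q → 0 < toℕ b → size ⌜ b ⌝ ≤ n → size ⌜ b ⌝ ≤ B →
        unwind q (toℕ p + toℕ a * toℕ b) < 2 ^ L → MulLoop io ρ n a b p q

      exec-mulLoop n zero p q _ bb lt =
        p , q , cong (unwind q) (sym eq) , loop-done 1≤B (bounded zero p q bb lt) refl
        where
        eq : toℕ p + toℕ a * 0 ≡ toℕ p
        eq = trans (cong (toℕ p +_) (*-zeroʳ (toℕ a))) (+-identityʳ _)
      exec-mulLoop n 2[1+ b ] p q = exec-mulStep n 2[1+ b ] p q (s≤s z≤n)
      exec-mulLoop n 1+[2 b ] p q = exec-mulStep n 1+[2 b ] p q (s≤s z≤n)

      exec-mulStep zero    b p q _   b≤0 bb lt with () ← ≤-trans (size>0 ⌜ b ⌝) b≤0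
      exec-mulStep (suc n) b p q 0<b b≤n bb lt =
        let t , u , b≡         = nonleaf b 0<b
            p₁ , eq₁ , added   = exec-addMultiple {io} {ρ} a b p q 0<b sum<2^L ba bio bb (stack≤B₀ q _ lt) bρ
            p₁<2^L             = subst (_< 2 ^ L) (sym eq₁) sum<2^L
            p′ , q′ , eq , ex  = exec-mulLoop n (rest b) (rest p₁) (pushLow p₁ q)
                                   (s≤s⁻¹ (≤-trans (size-rest-< b 0<b) b≤n)) (≤-trans (size-rest b) bb)
                                   (subst (_< 2 ^ L) (sym (shifted p₁ eq₁)) lt)
        in p′ , q′ , trans eq (shifted p₁ eq₁) ,
           loop-step {x = 9F} {ρ = mulState io a b p q ρ} 1≤B (bounded b p q bb lt) b≡
             (added ⟫ exec-run {ρ = mulState io a b p₁ q ρ} shift 1≤B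
               (bio ∷ 1≤B ∷ 1≤B ∷ 1≤B ∷ 1≤B ∷ 1≤B ∷ 1≤B ∷ 1≤B ∷ ba ∷ bb
                ∷ ⌜⌝≤B p₁ p₁<2^L ∷ stack≤B₀ q _ lt ∷ bρ)
               (run-shift io a b p₁ q ρ (0<p₁ p₁ eq₁)))
             ex
        where
        -- The partial sum never exceeds the final product, so the single bound on the product
        -- serves every round.
        sum<2^L : toℕ p + digit b * toℕ a < 2 ^ L
        sum<2^L = ≤-<-trans
          (≤-trans (+-monoʳ-≤ (toℕ p)
            (≤-trans (≤-reflexive (*-comm (digit b) (toℕ a)))
              (*-monoʳ-≤ (toℕ a) (≤-trans (m≤m+n _ _) (≤-reflexive (sym (toℕ-digit b)))))))
            (≤-unwind q _)) lt
        0<p₁ : ∀ p₁ → toℕ p₁ ≡ toℕ p + digit b * toℕ a → 0 < toℕ p₁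
        0<p₁ p₁ eq₁ = ≤-trans (*-mono-≤ (0<digit b 0<b) 0<a)
          (≤-trans (m≤n+m _ (toℕ p)) (≤-reflexive (sym eq₁)))
        rearrange : ∀ p d a r → p + d * a + 2 * (a * r) ≡ p + a * (d + 2 * r)
        rearrange = solve-∀
        shifted : ∀ p₁ → toℕ p₁ ≡ toℕ p + digit b * toℕ a →
          unwind (pushLow p₁ q) (toℕ (rest p₁) + toℕ a * toℕ (rest b)) ≡
          unwind q (toℕ p + toℕ a * toℕ b)
        shifted p₁ eq₁ = trans (unwind-pushLow p₁ q _ (0<p₁ p₁ eq₁)) (cong (unwind q)
          (trans (cong (_+ 2 * (toℕ a * toℕ (rest b))) eq₁)
          (trans (rearrange (toℕ p) (digit b) (toℕ a) (toℕ (rest b)))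
                 (cong (λ n → toℕ p + toℕ a * n) (sym (toℕ-digit b))))))

      exec-mul : ∀ b → size ⌜ b ⌝ ≤ B → toℕ a * toℕ b < 2 ^ L →
        Exec mulCmd (mulState io a b zero zero ρ)
          (io ∷ leaf ∷ leaf ∷ leaf ∷ leaf ∷ ⌜ a ℕᵇ.* b ⌝ ∷ leaf ∷ leaf
              ∷ ⌜ a ⌝ ∷ leaf ∷ leaf ∷ leaf ∷ ρ) mulTime
      exec-mul b bb lt =
        let p , q , eq , looped = exec-mulLoop B b zero zero bb bb lt
            q+p<2^L = subst (_< 2 ^ L) (sym eq) lt
            bp      = ⌜⌝≤B p (≤-<-trans (≤-unwind q _) q+p<2^L)
            bq      = stack≤B₀ q _ q+p<2^L
        in looped
           ⟫ exec-run {ρ = mulState io a zero p q ρ} {ρ′ = loaded p q} loadProduct 1≤B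
               (bio ∷ 1≤B ∷ 1≤B ∷ 1≤B ∷ 1≤B ∷ 1≤B ∷ 1≤B ∷ 1≤B ∷ ba ∷ 1≤B ∷ bp ∷ bq ∷ bρ) refl
           ⟫ exec-unwind B ⌜ q ⌝ ⌜ p ⌝ bq (stack≤B q p q+p<2^L)
               (bio ∷ 1≤B ∷ 1≤B ∷ 1≤B ∷ []) (1≤B ∷ 1≤B ∷ ba ∷ 1≤B ∷ bp ∷ bq ∷ bρ)
           ⟫ exec-run {ρ = unwound p q} clearProduct 1≤B
               (bio ∷ 1≤B ∷ 1≤B ∷ 1≤B ∷ 1≤B
                ∷ subst (λ t → size t ≤ B) (sym (product p q eq)) (⌜⌝≤B (a ℕᵇ.* b)
                    (subst (_< 2 ^ L) (sym (ℕᵇ.toℕ-homo-* a b)) lt))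
                ∷ 1≤B ∷ 1≤B ∷ ba ∷ 1≤B ∷ bp ∷ bq ∷ bρ)
               (cong (λ t → io ∷ leaf ∷ leaf ∷ leaf ∷ leaf ∷ t ∷ leaf ∷ leaf
                              ∷ ⌜ a ⌝ ∷ leaf ∷ leaf ∷ leaf ∷ ρ) (product p q eq))
        where
        loaded unwound : (p q : ℕᵇ) → Store 19
        loaded p q = io ∷ leaf ∷ leaf ∷ leaf ∷ ⌜ q ⌝ ∷ ⌜ p ⌝ ∷ leaf ∷ leaf
                        ∷ ⌜ a ⌝ ∷ leaf ∷ ⌜ p ⌝ ∷ ⌜ q ⌝ ∷ ρ
        unwound p q = io ∷ leaf ∷ leaf ∷ leaf ∷ leaf ∷ rev ⌜ q ⌝ ⌜ p ⌝ ∷ leaf ∷ leaf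
                         ∷ ⌜ a ⌝ ∷ leaf ∷ ⌜ p ⌝ ∷ ⌜ q ⌝ ∷ ρ
        product : ∀ p q → unwind q (toℕ p) ≡ toℕ a * toℕ b → rev ⌜ q ⌝ ⌜ p ⌝ ≡ ⌜ a ℕᵇ.* b ⌝
        product p q eq = trans (rev-⌜⌝ q p) (cong ⌜_⌝ (ℕᵇ.toℕ-injective
          (trans (toℕ-revᵇ q p) (trans eq (sym (ℕᵇ.toℕ-homo-* a b))))))

    cmpTime : ℕ
    cmpTime = loopTime B (straightTime cmpBody B) B + straightTime cmpEnd B

    exec-cmp : ∀ {io} {ρ : Store 15} x y → size io ≤ B → size ⌜ x ⌝ ≤ B → size ⌜ y ⌝ ≤ B → Bounded B ρ →
      Exec cmpCmd (io ∷ ⌜ x ⌝ ∷ ⌜ y ⌝ ∷ leaf ∷ ρ)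
                  (io ∷ leaf ∷ leaf ∷ flag (exceeds x y false) ∷ ρ) cmpTime
    exec-cmp {io} {ρ} x y bio bx by bρ =
      let y′ , c′ , eq , by′ , ex = exec-cmpLoop B x y false bx bx by
      in ex ⟫ exec-run {ρ = io ∷ leaf ∷ ⌜ y′ ⌝ ∷ flag c′ ∷ ρ} cmpEnd 1≤B
                (bio ∷ 1≤B ∷ by′ ∷ flag≤B c′ ∷ bρ)
                (trans (run-cmpEnd {io} {ρ} y′ c′)
                       (cong (λ c → io ∷ leaf ∷ leaf ∷ flag c ∷ ρ) (sym eq)))
      where
      flag≤B : ∀ c → size (flag c) ≤ B
      flag≤B false = 1≤B
      flag≤B true  = ≤-trans (s≤s (s≤s (s≤s z≤n))) 5≤B

      CmpLoop : ℕ → (x y : ℕᵇ) → Bool → Set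
      CmpLoop n x y c = ∃[ y′ ] ∃[ c′ ] exceeds x y c ≡ exceeds zero y′ c′ × size ⌜ y′ ⌝ ≤ B ×
        Exec (while var 1F loop cmpBody) (io ∷ ⌜ x ⌝ ∷ ⌜ y ⌝ ∷ flag c ∷ ρ)
             (io ∷ leaf ∷ ⌜ y′ ⌝ ∷ flag c′ ∷ ρ) (loopTime B (straightTime cmpBody B) n)

      exec-cmpLoop : ∀ n x y c → size ⌜ x ⌝ ≤ n → size ⌜ x ⌝ ≤ B → size ⌜ y ⌝ ≤ B → CmpLoop n x y c
      exec-cmpStep : ∀ n x y c → 0 < toℕ x → size ⌜ x ⌝ ≤ n → size ⌜ x ⌝ ≤ B → size ⌜ y ⌝ ≤ B →
        CmpLoop n x y c
      exec-cmpLoop n zero y c _ bx by =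
        y , c , refl , by , loop-done 1≤B (bio ∷ bx ∷ by ∷ flag≤B c ∷ bρ) refl
      exec-cmpLoop n 2[1+ x ] y c = exec-cmpStep n 2[1+ x ] y c (s≤s z≤n)
      exec-cmpLoop n 1+[2 x ] y c = exec-cmpStep n 1+[2 x ] y c (s≤s z≤n)
      exec-cmpStep zero    x y c _   x≤0 _  _ with () ← ≤-trans (size>0 ⌜ x ⌝) x≤0
      exec-cmpStep (suc n) x y c 0<x x≤n bx by =
        let t , u , x≡               = nonleaf x 0<x
            c₁ , eq₁ , run≡          = run-cmpBody {io} {ρ} x y c 0<x
            y′ , c′ , eq , by′ , ex  = exec-cmpLoop n (rest x) (rest y) c₁
                                         (s≤s⁻¹ (≤-trans (size-rest-< x 0<x) x≤n))
                                         (≤-trans (size-rest x) bx) (≤-trans (size-rest y) by)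
            bounded = bio ∷ bx ∷ by ∷ flag≤B c ∷ bρ
        in y′ , c′ , trans eq₁ eq , by′ ,
           loop-step {x = 1F} 1≤B bounded x≡ (exec-run cmpBody 1≤B bounded run≡) ex

  -- Selection of a type with least rate

  pattern 12F = suc 11F
  pattern 13F = suc 12F
  pattern 14F = suc 13F
  pattern 15F = suc 14F
  pattern 16F = suc 15F
  pattern 17F = suc 16F
  pattern 18F = suc 17F

  -- Variables 12 to 18: remaining machine types, least rate so far (numerator and
  -- denominator), its index, machine counts, a list of zeros, first product.

  num den : Expr 19
  num = hd (tl (tl (hd (var 12F))))
  den = tl (tl (tl (hd (var 12F))))

  loadFirst loadSecond loadProducts keep₁ keep₂ replace advance : Cmd 19
  loadFirst    = 8F ≔ num ⨾ 9F ≔ var 14F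
  loadSecond   = 18F ≔ var 5F ⨾ 5F ≔ nil ⨾ 8F ≔ var 13F ⨾ 9F ≔ den
  loadProducts = 1F ≔ var 18F ⨾ 2F ≔ var 5F ⨾ 5F ≔ nil
  keep₁        = 1F ≔ var 15F ⨾ 2F ≔ cons (cons nil nil) nil
  keep₂        = 15F ≔ var 5F ⨾ 5F ≔ nil ⨾ 16F ≔ cons nil (var 16F)
  replace      = 13F ≔ num ⨾ 14F ≔ den ⨾ 15F ≔ nil ⨾ 16F ≔ cons (cons (cons nil nil) nil) (var 17F)
  advance      = 17F ≔ cons nil (var 17F) ⨾ 12F ≔ tl (var 12F)

  update pickBody : Cmd 19
  update   = test var 3F yes (keep₁ ⨾ addCmd ⨾ keep₂) no replace
  pickBody = loadFirst ⨾ mulCmd ⨾ loadSecond ⨾ mulCmd ⨾ loadProducts ⨾ cmpCmd ⨾ update ⨾ advance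

  record Item : Set where
    constructor item
    field
      fixedCost capacity    : Tree
      numerator denominator : ℕᵇ

  itemTree : Item → Tree
  itemTree (item f c n d) = f ∙ (c ∙ (⌜ n ⌝ ∙ ⌜ d ⌝))

  itemsTree : List Item → Tree
  itemsTree = foldr (λ i t → itemTree i ∙ t) leaf

  rev-itemsTree : ∀ is js → rev (itemsTree is) (itemsTree js) ≡ itemsTree (foldl (flip _∷_) js is)
  rev-itemsTree []       js = refl
  rev-itemsTree (i ∷ is) js = rev-itemsTree is (i ∷ js)

  record Best : Set where
    constructor best
    field
      bn bd index  : ℕᵇ
      counts zeros : Tree

  one : ℕᵇ
  one = 1+[2 zero ]

  -- The rate 1/0 plays the role of +∞.
  none : Best
  none = best one zero zero leaf leaf

  -- Types are visited from last to first, so the new type takes index 0 and shifts all later ones.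
  -- A kept winner gets its index increased and a zero count put in front; a new winner gets count
  -- one followed by zeros for the later types, which `zs` supplies.
  select : Bool → Item → Best → Best
  select true  _              (best bn bd i cs zs) = best bn bd (i ℕᵇ.+ one) (leaf ∙ cs) (leaf ∙ zs)
  select false (item _ _ n d) (best bn bd i cs zs) = best n d zero (⌜ one ⌝ ∙ zs) (leaf ∙ zs)

  worse : Item → Best → Bool
  worse (item _ _ n d) (best bn bd _ _ _) = exceeds (n ℕᵇ.* bd) (bn ℕᵇ.* d) false

  pick : Item → Best → Best
  pick i s = select (worse i s) i s

  pickState : Tree → Tree → Tree → Best → Tree → Store 19
  pickState io a ts (best bn bd i cs zs) u =
    io ∷ leaf ∷ leaf ∷ leaf ∷ leaf ∷ leaf ∷ leaf ∷ leaf ∷ a ∷ leaf ∷ leaf ∷ leaf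
       ∷ ts ∷ ⌜ bn ⌝ ∷ ⌜ bd ⌝ ∷ ⌜ i ⌝ ∷ cs ∷ zs ∷ u ∷ []

  n<2^n : ∀ n → n < 2 ^ n
  n<2^n zero    = s≤s z≤n
  n<2^n (suc n) = ≤-trans (+-mono-≤ (≤-trans (s≤s z≤n) (n<2^n n)) (n<2^n n))
                          (≤-reflexive (cong (2 ^ n +_) (sym (+-identityʳ (2 ^ n)))))

  -- The complete solver

  loadTypes loadRates loadJobs assignBody finish solver : Cmd 19
  loadTypes  = 4F ≔ tl (var 0F)
  loadRates  = 12F ≔ var 5F ⨾ 5F ≔ nil ⨾ 13F ≔ cons (cons nil nil) nil
  loadJobs   = 4F ≔ hd (var 0F)
  -- Each job is sent to machine number 0 of the selected type; `nil` is the code of that 0.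
  assignBody = 5F ≔ cons (cons (var 15F) nil) (var 5F) ⨾ 4F ≔ tl (var 4F)
  finish     = 0F ≔ cons (var 16F) (var 5F)
  solver     = loadTypes ⨾ unwindCmd ⨾ loadRates ⨾ (while var 12F loop pickBody)
             ⨾ loadJobs ⨾ (while var 4F loop assignBody) ⨾ finish

  constant : Tree → Tree → Tree
  constant leaf    e = leaf
  constant (_ ∙ t) e = e ∙ constant t e

  prepend : Tree → Tree → Tree → Tree
  prepend leaf    e z = z
  prepend (_ ∙ t) e z = prepend t e (e ∙ z)

  prepend-∙ : ∀ t e z → prepend t e (e ∙ z) ≡ e ∙ prepend t e z
  prepend-∙ leaf    e z = refl
  prepend-∙ (_ ∙ t) e z = prepend-∙ t e (e ∙ z)

  -- The loop builds the assignment list back to front; as all entries are equal, this does not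
  -- change the list.
  prepend-leaf : ∀ t e → prepend t e leaf ≡ constant t e
  prepend-leaf leaf    e = refl
  prepend-leaf (_ ∙ t) e = trans (prepend-∙ t e leaf) (cong (e ∙_) (prepend-leaf t e))

  size-constant : ∀ t e → size (constant t e) ≤ size t * suc (size e) + 1
  size-constant leaf    e = m≤n+m 1 (1 * suc (size e))
  size-constant (h ∙ t) e = begin
    suc (size e + size (constant t e))             ≤⟨ +-monoʳ-≤ (suc (size e)) (size-constant t e) ⟩
    suc (size e) + (size t * suc (size e) + 1)     ≡⟨ +-assoc (suc (size e)) (size t * suc (size e)) 1 ⟨
    suc (size t) * suc (size e) + 1                ≤⟨ +-monoˡ-≤ 1 (*-monoˡ-≤ (suc (size e))
                                                          (s≤s (m≤n+m (size t) (size h)))) ⟩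
    size (h ∙ t) * suc (size e) + 1                ∎
    where open ≤-Reasoning

  length≤size : ∀ is → length is ≤ size (itemsTree is)
  length≤size []       = z≤n
  length≤size (i ∷ is) = s≤s (≤-trans (length≤size is) (m≤n+m _ (size (itemTree i))))

  -- Executions of the selection and of the solver

  module Selection (N B : ℕ) (8N+5≤B : 4 * (N + N) + 5 ≤ B) (6N+1≤B : 6 * N + 1 ≤ B) where
    open Multiplication (N + N) B 8N+5≤B

    -- Multiplication requires a positive multiplicand. In both cross products that is a numerator,
    -- so the denominator may be 0, as it is in `none`.
    record Positive<2^N (n d : ℕᵇ) : Set where
      field
        n>0   : 0 < toℕ n
        n<2^N : toℕ n < 2 ^ N
        d<2^N : toℕ d < 2 ^ N
    open Positive<2^N

    Small : Item → Set
    Small (item _ _ n d) = Positive<2^N n d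

    record Invariant (k : ℕ) (s : Best) : Set where
      open Best s
      field
        rate     : Positive<2^N bn bd
        index≤   : toℕ index ≤ k
        counts≤  : size counts ≤ 6 * k + 1
        zeros≤   : size zeros ≤ 2 * k + 1
    open Invariant

    private
      eq₆ : ∀ k → 6 + (6 * k + 1) ≡ 6 * suc k + 1
      eq₆ = solve-∀

      eq₂ : ∀ k → 2 + (2 * k + 1) ≡ 2 * suc k + 1
      eq₂ = solve-∀

    select-invariant : ∀ {k it s} c → Small it → Invariant k s → Invariant (suc k) (select c it s)
    select-invariant {k} {s = best _ _ i _ _} true small inv = record
      { rate    = rate inv
      ; index≤  = ≤-trans (≤-reflexive (trans (ℕᵇ.toℕ-homo-+ i one) (+-comm (toℕ i) 1))) (s≤s (index≤ inv))
      ; counts≤ = ≤-trans (+-mono-≤ (m≤m+n 2 4) (counts≤ inv)) (≤-reflexive (eq₆ k))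
      ; zeros≤  = ≤-trans (+-monoʳ-≤ 2 (zeros≤ inv)) (≤-reflexive (eq₂ k))
      }
    select-invariant {k} false small inv = record
      { rate    = small
      ; index≤  = z≤n
      ; counts≤ = ≤-trans (+-monoʳ-≤ 6 (≤-trans (zeros≤ inv) (+-monoˡ-≤ 1 (*-monoˡ-≤ k (m≤m+n 2 4)))))
                          (≤-reflexive (eq₆ k))
      ; zeros≤  = ≤-trans (+-monoʳ-≤ 2 (zeros≤ inv)) (≤-reflexive (eq₂ k))
      }

    *-<2^L : ∀ {m n} → m < 2 ^ N → n < 2 ^ N → m * n < 2 ^ (N + N)
    *-<2^L m< n< = subst (_ <_) (sym (^-distribˡ-+-* 2 N N)) (*-mono-< m< n<)

    2^N≤2^L : 2 ^ N ≤ 2 ^ (N + N)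
    2^N≤2^L = ^-monoʳ-≤ 2 (m≤m+n N N)

    <2^N⇒<2^L : ∀ {n} → n < 2 ^ N → n < 2 ^ (N + N)
    <2^N⇒<2^L n< = <-≤-trans n< 2^N≤2^L

    updateTime pickBodyTime : ℕ
    updateTime = 2 * B + (straightTime keep₁ B + (addTime + straightTime keep₂ B) + straightTime replace B)
    pickBodyTime = straightTime loadFirst B + (mulTime + (straightTime loadSecond B + (mulTime +
      (straightTime loadProducts B + (cmpTime + (updateTime + straightTime advance B))))))

    module _ {io : Tree} (bio : size io ≤ B) where

      record PickBounded (ts : Tree) (s : Best) : Set where
        field
          bts  : size ts ≤ B
          bbn  : size ⌜ Best.bn s ⌝ ≤ B
          bbd  : size ⌜ Best.bd s ⌝ ≤ B
          bi   : size ⌜ Best.index s ⌝ ≤ B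
          bcs  : size (Best.counts s) ≤ B
          bzs  : size (Best.zeros s) ≤ B

      pickBounded : ∀ {k ts s} → k ≤ N → Invariant k s → size ts ≤ B → PickBounded ts s
      pickBounded k≤N inv bts = record
        { bts = bts
        ; bbn = ⌜⌝≤B _ (<2^N⇒<2^L (n<2^N (rate inv)))
        ; bbd = ⌜⌝≤B _ (<2^N⇒<2^L (d<2^N (rate inv)))
        ; bi  = ⌜⌝≤B _ (<2^N⇒<2^L (≤-<-trans (≤-trans (index≤ inv) k≤N) (n<2^n N)))
        ; bcs = ≤-trans (counts≤ inv) (≤-trans (+-monoˡ-≤ 1 (*-monoʳ-≤ 6 k≤N)) 6N+1≤B)
        ; bzs = ≤-trans (zeros≤ inv) (≤-trans (+-mono-≤ (*-mono-≤ (m≤m+n 2 4) k≤N) ≤-refl) 6N+1≤B)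
        }

      -- Between `update` and `advance` the counts already belong to the new selection while the
      -- list of zeros is still the old one.
      withZeros : ∀ {ts bn bd i cs zs zs′} → PickBounded ts (best bn bd i cs zs) → size zs′ ≤ B →
                  PickBounded ts (best bn bd i cs zs′)
      withZeros pb b = record { bts = bts ; bbn = bbn ; bbd = bbd ; bi = bi ; bcs = bcs ; bzs = b }
        where open PickBounded pb

      state-bounded : ∀ {ts s} (a u : Tree) → size a ≤ B → size u ≤ B → PickBounded ts s →
                      Bounded B (pickState io a ts s u)
      state-bounded a u ba bu pb =
        bio ∷ 1≤B ∷ 1≤B ∷ 1≤B ∷ 1≤B ∷ 1≤B ∷ 1≤B ∷ 1≤B ∷ ba ∷ 1≤B ∷ 1≤B ∷ 1≤B
          ∷ bts ∷ bbn ∷ bbd ∷ bi ∷ bcs ∷ bzs ∷ bu ∷ []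
        where open PickBounded pb

      exec-update : ∀ {k} a ts it s u → suc k ≤ N → Small it → Invariant k s →
        size a ≤ B → size (itemTree it ∙ ts) ≤ B → size u ≤ B → (c : Bool) →
        let best bn bd i cs zs    = s
            best bn′ bd′ i′ cs′ _ = select c it s in
        Exec update
          (io ∷ leaf ∷ leaf ∷ flag c ∷ leaf ∷ leaf ∷ leaf ∷ leaf ∷ a ∷ leaf ∷ leaf ∷ leaf
            ∷ (itemTree it ∙ ts) ∷ ⌜ bn ⌝ ∷ ⌜ bd ⌝ ∷ ⌜ i ⌝ ∷ cs ∷ zs ∷ u ∷ [])
          (pickState io a (itemTree it ∙ ts) (best bn′ bd′ i′ cs′ zs) u) updateTime
      exec-update {k} a ts it s@(best bn bd i cs zs) u k<N small inv ba bts bu true =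
        weaken (+-monoʳ-≤ (2 * B) (m≤m+n _ _))
          (exec-yes 1≤B (bio ∷ 1≤B ∷ 1≤B ∷ 3≤B ∷ tail bρ) refl
            (exec-run keep₁ 1≤B (bio ∷ 1≤B ∷ 1≤B ∷ 3≤B ∷ tail bρ) refl
             ⟫ exec-add i one
                 (subst (_< 2 ^ (N + N)) (+-comm 1 (toℕ i))
                   (<2^N⇒<2^L (≤-<-trans (≤-trans (s≤s (index≤ inv)) k<N) (n<2^n N))))
                 (bio ∷ bi ∷ 5≤B ∷ 3≤B ∷ tail bρ)
             ⟫ exec-run keep₂ 1≤B
                 (bio ∷ 1≤B ∷ 1≤B ∷ 1≤B ∷ 1≤B ∷ bi′ ∷ 1≤B ∷ 1≤B ∷ tail (tail bρ)) refl))
        where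
        pb = pickBounded {ts = itemTree it ∙ ts} (≤-trans (n≤1+n k) k<N) inv bts
        open PickBounded pb using (bi)
        bρ = state-bounded a u ba bu pb
        3≤B : 3 ≤ B
        3≤B = ≤-trans (s≤s (s≤s (s≤s z≤n))) 5≤B
        bi′ : size ⌜ i ℕᵇ.+ one ⌝ ≤ B
        bi′ = ⌜⌝≤B (i ℕᵇ.+ one) (subst (_< 2 ^ (N + N))
                (sym (trans (ℕᵇ.toℕ-homo-+ i one) (+-comm (toℕ i) 1)))
                (<2^N⇒<2^L (≤-<-trans (≤-trans (s≤s (index≤ inv)) k<N) (n<2^n N))))
        tail : ∀ {w x y z k} {ρ : Store k} → Bounded B (w ∷ x ∷ y ∷ z ∷ ρ) → Bounded B ρ
        tail (_ ∷ _ ∷ _ ∷ _ ∷ b) = b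
      exec-update {k} a ts it s u k<N small inv ba bts bu false =
        weaken (+-monoʳ-≤ (2 * B) (m≤n+m _ _))
          (exec-no 1≤B bρ refl (exec-run replace 1≤B bρ refl))
        where
        bρ = state-bounded a u ba bu (pickBounded {ts = itemTree it ∙ ts} (≤-trans (n≤1+n k) k<N) inv bts)

      exec-pickBody : ∀ {k} a ts it s u → suc k ≤ N → Small it → Invariant k s →
        size a ≤ B → size (itemTree it ∙ ts) ≤ B → size u ≤ B →
        Exec pickBody (pickState io a (itemTree it ∙ ts) s u)
          (pickState io ⌜ Best.bn s ⌝ ts (pick it s) ⌜ Item.numerator it ℕᵇ.* Best.bd s ⌝) pickBodyTime
      exec-pickBody {k} a ts it@(item f c n d) s@(best bn bd i cs zs) u k<N small inv ba bts bu =
        exec-run {ρ = pickState io a ts₀ s u}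
                 {ρ′ = mulState io n bd zero zero (best₀ u)} loadFirst 1≤B bρ refl
        ⟫ exec-mul bio (bbest bu) n (n>0 small) bn′ bd bbd nbd<
        ⟫ exec-run {ρ = io ∷ leaf ∷ leaf ∷ leaf ∷ leaf ∷ ⌜ n ℕᵇ.* bd ⌝ ∷ leaf ∷ leaf
                           ∷ ⌜ n ⌝ ∷ leaf ∷ leaf ∷ leaf ∷ best₀ u}
                   {ρ′ = mulState io bn d zero zero (best₀ ⌜ n ℕᵇ.* bd ⌝)} loadSecond 1≤B
            (bio ∷ 1≤B ∷ 1≤B ∷ 1≤B ∷ 1≤B ∷ bnbd ∷ 1≤B ∷ 1≤B ∷ bn′ ∷ 1≤B ∷ 1≤B ∷ 1≤B ∷ bbest bu) refl
        ⟫ exec-mul bio (bbest bnbd) bn (n>0 (rate inv)) bbn d bd′ bnd<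
        ⟫ exec-run {ρ = io ∷ leaf ∷ leaf ∷ leaf ∷ leaf ∷ ⌜ bn ℕᵇ.* d ⌝ ∷ leaf ∷ leaf
                           ∷ ⌜ bn ⌝ ∷ leaf ∷ leaf ∷ leaf ∷ best₀ ⌜ n ℕᵇ.* bd ⌝}
                   {ρ′ = io ∷ ⌜ n ℕᵇ.* bd ⌝ ∷ ⌜ bn ℕᵇ.* d ⌝ ∷ leaf ∷ leaf ∷ leaf ∷ leaf ∷ leaf
                           ∷ ⌜ bn ⌝ ∷ leaf ∷ leaf ∷ leaf ∷ best₀ ⌜ n ℕᵇ.* bd ⌝} loadProducts 1≤B
            (bio ∷ 1≤B ∷ 1≤B ∷ 1≤B ∷ 1≤B ∷ bbnd ∷ 1≤B ∷ 1≤B ∷ bbn ∷ 1≤B ∷ 1≤B ∷ 1≤B ∷ bbest bnbd) refl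
        ⟫ exec-cmp (n ℕᵇ.* bd) (bn ℕᵇ.* d) bio bnbd bbnd
            (1≤B ∷ 1≤B ∷ 1≤B ∷ 1≤B ∷ bbn ∷ 1≤B ∷ 1≤B ∷ 1≤B ∷ bbest bnbd)
        ⟫ exec-update ⌜ bn ⌝ ts it s ⌜ n ℕᵇ.* bd ⌝ k<N small inv bbn bts bnbd (worse it s)
        ⟫ exec-advance (worse it s)
        where
        ts₀ = itemTree it ∙ ts
        best₀ : Tree → Store 7
        best₀ u = ts₀ ∷ ⌜ bn ⌝ ∷ ⌜ bd ⌝ ∷ ⌜ i ⌝ ∷ cs ∷ zs ∷ u ∷ []
        pb = pickBounded {ts = ts₀} (≤-trans (n≤1+n k) k<N) inv bts
        open PickBounded pb using (bbn; bbd; bi; bcs; bzs)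
        bρ = state-bounded a u ba bu pb
        bbest : ∀ {u} → size u ≤ B → Bounded B (best₀ u)
        bbest bu = bts ∷ bbn ∷ bbd ∷ bi ∷ bcs ∷ bzs ∷ bu ∷ []
        nbd< : toℕ n * toℕ bd < 2 ^ (N + N)
        nbd< = *-<2^L (n<2^N small) (d<2^N (rate inv))
        bnd< : toℕ bn * toℕ d < 2 ^ (N + N)
        bnd< = *-<2^L (n<2^N (rate inv)) (d<2^N small)
        bn′ : size ⌜ n ⌝ ≤ B
        bn′ = ⌜⌝≤B n (<2^N⇒<2^L (n<2^N small))
        bd′ : size ⌜ d ⌝ ≤ B
        bd′ = ⌜⌝≤B d (<2^N⇒<2^L (d<2^N small))
        bnbd : size ⌜ n ℕᵇ.* bd ⌝ ≤ B
        bnbd = ⌜⌝≤B (n ℕᵇ.* bd) (subst (_< 2 ^ (N + N)) (sym (ℕᵇ.toℕ-homo-* n bd)) nbd<)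
        bbnd : size ⌜ bn ℕᵇ.* d ⌝ ≤ B
        bbnd = ⌜⌝≤B (bn ℕᵇ.* d) (subst (_< 2 ^ (N + N)) (sym (ℕᵇ.toℕ-homo-* bn d)) bnd<)
        exec-advance : ∀ w → let best bn₁ bd₁ i₁ cs₁ _ = select w it s in
          Exec advance (pickState io ⌜ bn ⌝ ts₀ (best bn₁ bd₁ i₁ cs₁ zs) ⌜ n ℕᵇ.* bd ⌝)
            (pickState io ⌜ bn ⌝ ts (select w it s) ⌜ n ℕᵇ.* bd ⌝) (straightTime advance B)
        exec-advance w with pickBounded {ts = ts₀} k<N (select-invariant {it = it} {s = s} w small inv) bts
        exec-advance true  | pb′ = exec-run advance 1≤B
          (state-bounded ⌜ bn ⌝ ⌜ n ℕᵇ.* bd ⌝ bbn bnbd (withZeros pb′ bzs)) refl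
        exec-advance false | pb′ = exec-run advance 1≤B
          (state-bounded ⌜ bn ⌝ ⌜ n ℕᵇ.* bd ⌝ bbn bnbd (withZeros pb′ bzs)) refl

      -- `a′` and `u′` are leftovers in the multiplicand and first-product variables; only their
      -- sizes matter afterwards.
      PickLoop : ℕ → Tree → List Item → Best → Tree → Set
      PickLoop n a is s u = ∃[ a′ ] ∃[ u′ ] size a′ ≤ B × size u′ ≤ B ×
        Exec (while var 12F loop pickBody) (pickState io a (itemsTree is) s u)
          (pickState io a′ leaf (foldl (flip pick) s is) u′) (loopTime B pickBodyTime n)

      exec-pickLoop : ∀ {k n} is a s u → k + length is ≤ N → length is ≤ n →
        LAll.All Small is → Invariant k s →
        size a ≤ B → size (itemsTree is) ≤ B → size u ≤ B → PickLoop n a is s u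
      exec-pickLoop {k} [] a s u k≤N _ _ inv ba bts bu = a , u , ba , bu ,
        loop-done 1≤B (state-bounded a u ba bu (pickBounded (≤-trans (m≤m+n k 0) k≤N) inv bts)) refl
      exec-pickLoop {k} {suc n} (it ∷ is) a s u k≤N (s≤s is≤n) (small LAll.∷ smalls) inv ba bts bu =
        let k+1≤N                     = subst (_≤ N) (+-suc k (length is)) k≤N
            bnbd                      = ⌜⌝≤B (Item.numerator it ℕᵇ.* Best.bd s)
                                          (subst (_< 2 ^ (N + N))
                                            (sym (ℕᵇ.toℕ-homo-* (Item.numerator it) (Best.bd s)))
                                            (*-<2^L (n<2^N small) (d<2^N (rate inv))))
            pb                        = pickBounded (≤-trans (m≤m+n k _) k≤N) inv bts
            a′ , u′ , ba′ , bu′ , ex  = exec-pickLoop is ⌜ Best.bn s ⌝ (pick it s) _ k+1≤N is≤n smalls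
                                          (select-invariant {it = it} {s = s} (worse it s) small inv)
                                          (PickBounded.bbn pb)
                                          (≤-trans (m≤n+m _ _) (≤-trans (n≤1+n _) bts)) bnbd
        in a′ , u′ , ba′ , bu′ ,
           loop-step {x = 12F} 1≤B (state-bounded a u ba bu pb) refl
             (exec-pickBody a (itemsTree is) it s u (≤-trans (m≤m+n (suc k) _) k+1≤N) small inv ba bts bu)
             ex

      -- The bounded quantity is a potential: each job adds exactly `3 + size i` to the output (the
      -- index, a leaf and two inner vertices) and removes at least one vertex from `t`.
      exec-assign : ∀ {a ts bn bd i cs zs u} n t z → size t ≤ n →
        Bounded B (a ∷ leaf ∷ leaf ∷ leaf ∷ ts ∷ bn ∷ bd ∷ i ∷ cs ∷ zs ∷ u ∷ []) →
        size t * (3 + size i) + size z ≤ B →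
        Exec (while var 4F loop assignBody)
          (io ∷ leaf ∷ leaf ∷ leaf ∷ t ∷ z ∷ leaf ∷ leaf
              ∷ a ∷ leaf ∷ leaf ∷ leaf ∷ ts ∷ bn ∷ bd ∷ i ∷ cs ∷ zs ∷ u ∷ [])
          (io ∷ leaf ∷ leaf ∷ leaf ∷ leaf ∷ prepend t (i ∙ leaf) z ∷ leaf ∷ leaf
              ∷ a ∷ leaf ∷ leaf ∷ leaf ∷ ts ∷ bn ∷ bd ∷ i ∷ cs ∷ zs ∷ u ∷ [])
          (loopTime B (straightTime assignBody B) n)
      exec-assign n leaf z _ bρ le =
        loop-done 1≤B (bio ∷ 1≤B ∷ 1≤B ∷ 1≤B ∷ 1≤B ∷ ≤-trans (m≤n+m _ _) le ∷ 1≤B ∷ 1≤B ∷ bρ) refl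
      exec-assign {i = i} (suc n) (h ∙ t) z (s≤s t≤n) bρ le =
        loop-step 1≤B bounded refl (exec-run assignBody 1≤B bounded refl)
          (exec-assign n t ((i ∙ leaf) ∙ z) (≤-trans (m≤n+m _ (size h)) t≤n) bρ
            (≤-trans (≤-reflexive (rearrange (size t) (size i) (size z)))
              (≤-trans (+-monoˡ-≤ (size z) (*-monoˡ-≤ (3 + size i) (s≤s (m≤n+m (size t) (size h))))) le)))
        where
        rearrange : ∀ t i z → t * (3 + i) + (1 + (1 + (i + 1) + z)) ≡ (1 + t) * (3 + i) + z
        rearrange = solve-∀
        bounded = bio ∷ 1≤B ∷ 1≤B ∷ 1≤B
          ∷ ≤-trans (m≤m*n (size (h ∙ t)) (3 + size i)) (≤-trans (m≤m+n _ (size z)) le)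
          ∷ ≤-trans (m≤n+m _ _) le ∷ 1≤B ∷ 1≤B ∷ bρ

    solverTime : ℕ
    solverTime = straightTime loadTypes B + (unwindTime B + (straightTime loadRates B
      + (loopTime B pickBodyTime B + (straightTime loadJobs B
      + (loopTime B (straightTime assignBody B) B + straightTime finish B)))))

    exec-solver : ∀ jobs is → size (jobs ∙ itemsTree is) ≤ N → N * (3 + (8 * N + 1)) + 1 ≤ B →
      LAll.All Small is → let s = foldr pick none is in
      ∃[ ρ ] Exec solver ((jobs ∙ itemsTree is) ∷ Vec.replicate 18 leaf)
               ((Best.counts s ∙ constant jobs (⌜ Best.index s ⌝ ∙ leaf)) ∷ ρ) solverTime
    exec-solver jobs is input≤N N²≤B small =
      let a , u , ba , bu , looped = exec-pickLoop {io} bio {k = 0} (reverse is) leaf none leaf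
            (subst (_≤ N) (sym (length-reverse is)) length≤N)
            (≤-trans (subst (_≤ N) (sym (length-reverse is)) length≤N) N≤B)
            (All-resp-↭ (↭-sym (↭-reverse is)) small) none-invariant 1≤B reversed≤B 1≤B
          -- The program folds from the left over the reversed list, which is a right fold over the
          -- types and thus fits induction on them.
          looped′ = subst (λ s → Exec (while var 12F loop pickBody)
                        (pickState io leaf (itemsTree (reverse is)) none leaf) (pickState io a leaf s u)
                        (loopTime B pickBodyTime B))
                      (reverse-foldl (flip pick) none is) looped
          bρ = state-bounded bio a u ba bu pb
      in _ ,
         (exec-run {ρ′ = io ∷ leaf ∷ leaf ∷ leaf ∷ itemsTree is ∷ Vec.replicate 14 leaf} loadTypes 1≤B
           (bio ∷ leaves 18) refl
         ⟫ subst (λ t → Exec unwindCmd (io ∷ leaf ∷ leaf ∷ leaf ∷ itemsTree is ∷ Vec.replicate 14 leaf)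
                          (io ∷ leaf ∷ leaf ∷ leaf ∷ leaf ∷ t ∷ Vec.replicate 13 leaf) (unwindTime B))
             (rev-itemsTree is [])
             (exec-unwind B (itemsTree is) leaf types≤B
               (≤-trans (+-monoˡ-≤ 1 types≤B) (≤-reflexive (+-comm B 1)))
               (bio ∷ 1≤B ∷ 1≤B ∷ 1≤B ∷ []) (leaves 13))
         ⟫ exec-run {ρ′ = pickState io leaf (itemsTree (reverse is)) none leaf} loadRates 1≤B
             (bio ∷ 1≤B ∷ 1≤B ∷ 1≤B ∷ 1≤B ∷ reversed≤B ∷ leaves 13) refl
         ⟫ looped′
         ⟫ exec-run loadJobs 1≤B bρ refl
         ⟫ subst (λ t → Exec (while var 4F loop assignBody)
                          (io ∷ leaf ∷ leaf ∷ leaf ∷ jobs ∷ leaf ∷ rest′ a u)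
                          (io ∷ leaf ∷ leaf ∷ leaf ∷ leaf ∷ t ∷ rest′ a u)
                          (loopTime B (straightTime assignBody B) B))
             (prepend-leaf jobs (⌜ index ⌝ ∙ leaf))
             (exec-assign bio B jobs leaf jobs≤B
               (ba ∷ 1≤B ∷ 1≤B ∷ 1≤B ∷ 1≤B ∷ bbn ∷ bbd ∷ bi ∷ bcs ∷ bzs ∷ bu ∷ []) assignments≤B)
         ⟫ exec-run finish 1≤B
             (bio ∷ 1≤B ∷ 1≤B ∷ 1≤B ∷ 1≤B
              ∷ ≤-trans (size-constant jobs (⌜ index ⌝ ∙ leaf))
                  (≤-trans (≤-reflexive (cong (λ n → size jobs * (2 + n) + 1) (+-comm (size ⌜ index ⌝) 1)))
                         assignments≤B)
              ∷ 1≤B ∷ 1≤B ∷ ba ∷ 1≤B ∷ 1≤B ∷ 1≤B ∷ 1≤B ∷ bbn ∷ bbd ∷ bi ∷ bcs ∷ bzs ∷ bu ∷ []) refl)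
      where
      io = jobs ∙ itemsTree is
      N≤B : N ≤ B
      N≤B = ≤-trans (≤-trans (m≤m+n N (5 * N)) (m≤m+n (6 * N) 1)) 6N+1≤B
      bio : size io ≤ B
      bio = ≤-trans input≤N N≤B
      types≤N : size (itemsTree is) ≤ N
      types≤N = ≤-trans (≤-trans (m≤n+m _ (size jobs)) (n≤1+n _)) input≤N
      jobs≤N : size jobs ≤ N
      jobs≤N = ≤-trans (≤-trans (m≤m+n _ (size (itemsTree is))) (n≤1+n _)) input≤N
      types≤B = ≤-trans types≤N N≤B
      jobs≤B  = ≤-trans jobs≤N N≤B
      length≤N = ≤-trans (length≤size is) types≤N
      reversed≤B : size (itemsTree (reverse is)) ≤ B
      reversed≤B = subst (λ t → size t ≤ B) (rev-itemsTree is [])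
        (s≤s⁻¹ (≤-trans (≤-reflexive (size-rev (itemsTree is) leaf))
          (≤-trans (+-monoˡ-≤ 1 types≤B) (≤-reflexive (+-comm B 1)))))
      leaves : ∀ n → Bounded B (Vec.replicate n leaf)
      leaves zero    = []
      leaves (suc n) = 1≤B ∷ leaves n
      none-invariant : Invariant 0 none
      none-invariant = record
        { rate    = record
          { n>0   = ≤-refl
          ; n<2^N = ≤-<-trans (≤-trans (size>0 io) input≤N) (n<2^n N)
          ; d<2^N = ≤-<-trans z≤n (n<2^n N)
          }
        ; index≤  = ≤-refl
        ; counts≤ = ≤-refl
        ; zeros≤  = ≤-refl
        }
      fold-invariant : ∀ {is} → LAll.All Small is → Invariant (length is) (foldr pick none is)
      fold-invariant LAll.[]                     = none-invariant
      fold-invariant {it ∷ is} (small LAll.∷ smalls) =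
        select-invariant {it = it} {s = s} (worse it s) small (fold-invariant smalls)
        where s = foldr pick none is
      pb : PickBounded bio leaf (foldr pick none is)
      pb = pickBounded bio length≤N (fold-invariant small) 1≤B
      open PickBounded pb
      open Best (foldr pick none is)
      rest′ : Tree → Tree → Store 13
      rest′ a u = leaf ∷ leaf ∷ a ∷ leaf ∷ leaf ∷ leaf ∷ leaf ∷ ⌜ bn ⌝ ∷ ⌜ bd ⌝ ∷ ⌜ index ⌝
                  ∷ counts ∷ zeros ∷ u ∷ []
      index-size : size ⌜ index ⌝ ≤ 8 * N + 1
      index-size = ≤-trans (size-⌜⌝ index (N + N)
          (<2^N⇒<2^L (≤-<-trans (≤-trans (index≤ (fold-invariant small)) length≤N) (n<2^n N))))
        (≤-reflexive (eight N))
        where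
        eight : ∀ n → 4 * (n + n) + 1 ≡ 8 * n + 1
        eight = solve-∀
      assignments≤B : size jobs * (3 + size ⌜ index ⌝) + 1 ≤ B
      assignments≤B = ≤-trans (+-monoˡ-≤ 1 (*-mono-≤ jobs≤N (+-monoʳ-≤ 3 index-size))) N²≤B

open Programs

open import Data.Rational.Base
  using (ℚ; 0ℚ; 1ℚ; mkℚ; _+_; _*_; _-_; -_; _/_; ↥_; ↧ₙ_; _≤_; _<_; *≤*; *<*; Positive; nonNegative)
open import Data.Rational.Properties
import Data.Rational.Unnormalised.Base as ℚᵘ
import Data.Rational.Unnormalised.Properties as ℚᵘ
open import Data.List.Extrema (DecTotalOrder.totalOrder ≤-decTotalOrder)
  using (argmin; f[argmin]≤f[⊤]; f[argmin]≤f[xs])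

-- Polynomial time bounds

-- The fraction `k / 1` is already reduced; rewriting it to constructor form lets arithmetic and
-- comparison on it compute.
fromℕ-mkℚ : ∀ k → fromℕ k ≡ mkℚ (ℤ.+ k) 0 (coprime-sym (1-coprimeTo k))
fromℕ-mkℚ k = normalize-coprime (coprime-sym (1-coprimeTo k))

fromℕ-+ : ∀ m n → fromℕ (m ℕ.+ n) ≡ fromℕ m + fromℕ n
fromℕ-+ m n rewrite fromℕ-mkℚ m | fromℕ-mkℚ n =
  cong (_/ 1) (sym (cong₂ ℤ._+_ (ℤ.*-identityʳ (ℤ.+ m)) (ℤ.*-identityʳ (ℤ.+ n))))

fromℕ-* : ∀ m n → fromℕ (m ℕ.* n) ≡ fromℕ m * fromℕ n
fromℕ-* m n rewrite fromℕ-mkℚ m | fromℕ-mkℚ n = cong (_/ 1) (ℤ.pos-* m n)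

fromℕ-mono-≤ : ∀ {m n} → m ℕ.≤ n → fromℕ m ≤ fromℕ n
fromℕ-mono-≤ {m} {n} m≤n rewrite fromℕ-mkℚ m | fromℕ-mkℚ n =
  *≤* (ℤ.*-monoʳ-≤-nonNeg (ℤ.+ 1) (ℤ.+≤+ m≤n))

-- Equality rather than an upper bound makes closure under sums and products immediate, with no
-- monotonicity argument.
record Polynomial (f : ℕ → ℕ) : Set where
  constructor polynomial
  field
    poly   : Poly₂
    values : ∀ x n → fromℕ (f n) ≡ ⟦ poly ⟧ x (fromℕ n)
open Polynomial public

poly-const : ∀ k → Polynomial (λ _ → k)
poly-const k = polynomial (con (fromℕ k)) (λ _ _ → refl)

poly-id : Polynomial (λ n → n)
poly-id = polynomial Y (λ _ _ → refl)

infixl 6 _+ₚ_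
infixl 7 _*ₚ_

_+ₚ_ : ∀ {f g} → Polynomial f → Polynomial g → Polynomial (λ n → f n ℕ.+ g n)
_+ₚ_ {f} {g} (polynomial p f≡) (polynomial q g≡) =
  polynomial (p ⊕ q) (λ x n → trans (fromℕ-+ (f n) (g n)) (cong₂ _+_ (f≡ x n) (g≡ x n)))

_*ₚ_ : ∀ {f g} → Polynomial f → Polynomial g → Polynomial (λ n → f n ℕ.* g n)
_*ₚ_ {f} {g} (polynomial p f≡) (polynomial q g≡) =
  polynomial (p ⊗ q) (λ x n → trans (fromℕ-* (f n) (g n)) (cong₂ _*_ (f≡ x n) (g≡ x n)))

poly-≗ : ∀ {f g} → (∀ n → f n ≡ g n) → Polynomial f → Polynomial g
poly-≗ f≗g (polynomial p f≡) = polynomial p (λ x n → trans (cong fromℕ (sym (f≗g n))) (f≡ x n))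

module _ {B : ℕ → ℕ} (pB : Polynomial B) where

  poly-straight : ∀ {k} (C : Cmd k) → Polynomial (λ n → straightTime C (B n))
  poly-straight C = poly-≗ (λ n → sym (straightTime-≡ C (B n))) (poly-const (steps C) *ₚ pB)

  poly-loop : ∀ {T r} → Polynomial T → Polynomial r → Polynomial (λ n → loopTime (B n) (T n) (r n))
  poly-loop pT pr = poly-≗ (λ n → sym (loopTime-≡ (B n) _ _))
    (poly-const 2 *ₚ pB +ₚ pr *ₚ (poly-const 2 *ₚ pB +ₚ pT))

-- One quadratic above three demands: `8n + 5` for numbers below `2 ^ (n + n)` and small constants,
-- `6n + 1` for the count list (at most 6 per type), and the square for the index repeated over all
-- jobs.
bound : ℕ → ℕ
bound n = suc n ℕ.* (8 ℕ.* suc n)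

8n+5≤bound : ∀ n → 4 ℕ.* (n ℕ.+ n) ℕ.+ 5 ℕ.≤ bound n
8n+5≤bound n = ℕ.≤-trans (ℕ.m≤m+n _ (3 ℕ.+ n ℕ.* (8 ℕ.* suc n))) (ℕ.≤-reflexive (eq n))
  where
  eq : ∀ n → 4 ℕ.* (n ℕ.+ n) ℕ.+ 5 ℕ.+ (3 ℕ.+ n ℕ.* (8 ℕ.* suc n)) ≡ suc n ℕ.* (8 ℕ.* suc n)
  eq = solve-∀

6n+1≤bound : ∀ n → 6 ℕ.* n ℕ.+ 1 ℕ.≤ bound n
6n+1≤bound n = ℕ.≤-trans (ℕ.m≤m+n _ (7 ℕ.+ (2 ℕ.* n ℕ.+ n ℕ.* (8 ℕ.* suc n)))) (ℕ.≤-reflexive (eq n))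
  where
  eq : ∀ n → 6 ℕ.* n ℕ.+ 1 ℕ.+ (7 ℕ.+ (2 ℕ.* n ℕ.+ n ℕ.* (8 ℕ.* suc n))) ≡ suc n ℕ.* (8 ℕ.* suc n)
  eq = solve-∀

quadratic≤bound : ∀ n → n ℕ.* (3 ℕ.+ (8 ℕ.* n ℕ.+ 1)) ℕ.+ 1 ℕ.≤ bound n
quadratic≤bound n = ℕ.≤-trans (ℕ.m≤m+n _ (7 ℕ.+ 12 ℕ.* n)) (ℕ.≤-reflexive (eq n))
  where
  eq : ∀ n → n ℕ.* (3 ℕ.+ (8 ℕ.* n ℕ.+ 1)) ℕ.+ 1 ℕ.+ (7 ℕ.+ 12 ℕ.* n) ≡ suc n ℕ.* (8 ℕ.* suc n)
  eq = solve-∀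

module AtSize (n : ℕ) where
  open Multiplication (n ℕ.+ n) (bound n) (8n+5≤bound n) public
  open Selection n (bound n) (8n+5≤bound n) (6n+1≤bound n) public

pBound : Polynomial bound
pBound = (poly-const 1 +ₚ poly-id) *ₚ (poly-const 8 *ₚ (poly-const 1 +ₚ poly-id))

pUnwind : Polynomial (λ n → AtSize.unwindTime n (bound n))
pUnwind = poly-loop pBound (poly-straight pBound unwindBody) pBound

pAdd : Polynomial AtSize.addTime
pAdd = poly-straight pBound addInit
  +ₚ (poly-loop pBound (poly-straight pBound addBody) (poly-const 1 +ₚ (poly-id +ₚ poly-id)) +ₚ pUnwind)

pAddOperand : Polynomial AtSize.addOperandTime
pAddOperand = poly-straight pBound loadOperands +ₚ (pAdd +ₚ poly-straight pBound storeSum)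

pMul : Polynomial AtSize.mulTime
pMul = poly-loop pBound
    (poly-const 3 *ₚ pBound +ₚ (pAddOperand +ₚ pAddOperand) +ₚ poly-straight pBound shift) pBound
  +ₚ (poly-straight pBound loadProduct +ₚ (pUnwind +ₚ poly-straight pBound clearProduct))

pCmp : Polynomial AtSize.cmpTime
pCmp = poly-loop pBound (poly-straight pBound cmpBody) pBound +ₚ poly-straight pBound cmpEnd

pPick : Polynomial AtSize.pickBodyTime
pPick = poly-straight pBound loadFirst +ₚ (pMul +ₚ (poly-straight pBound loadSecond +ₚ (pMul
  +ₚ (poly-straight pBound loadProducts +ₚ (pCmp
  +ₚ (poly-const 2 *ₚ pBound
       +ₚ (poly-straight pBound keep₁ +ₚ (pAdd +ₚ poly-straight pBound keep₂) +ₚ poly-straight pBound replace)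
     +ₚ poly-straight pBound advance))))))

opaque
  pSolver : Polynomial AtSize.solverTime
  pSolver = poly-straight pBound loadTypes +ₚ (pUnwind +ₚ (poly-straight pBound loadRates
    +ₚ (poly-loop pBound pPick pBound +ₚ (poly-straight pBound loadJobs
    +ₚ (poly-loop pBound (poly-straight pBound assignBody) pBound +ₚ poly-straight pBound finish)))))

  polynomial-time : ∀ {x n t} → t ℕ.≤ AtSize.solverTime n → fromℕ t ≤ ⟦ poly pSolver ⟧ x (fromℕ n)
  polynomial-time {x} {n} t≤ = ≤-trans (fromℕ-mono-≤ t≤) (≤-reflexive (values pSolver x n))

-- Correctness of the program

numᵇ denᵇ : ℚ → ℕᵇ
numᵇ q = ℕᵇ.fromℕ ℤ.∣ ↥ q ∣
denᵇ q = ℕᵇ.fromℕ (↧ₙ q)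

toℕ-cross : ∀ q r → ℕᵇ.toℕ (numᵇ q ℕᵇ.* denᵇ r) ≡ ℤ.∣ ↥ q ∣ ℕ.* ↧ₙ r
toℕ-cross q r = trans (ℕᵇ.toℕ-homo-* (numᵇ q) (denᵇ r))
  (cong₂ ℕ._*_ (ℕᵇ.toℕ-fromℕ ℤ.∣ ↥ q ∣) (ℕᵇ.toℕ-fromℕ (↧ₙ r)))

-- `numᵇ` takes absolute values, so nonnegativity is what turns the comparison of natural cross
-- products into one of rationals.
cross-≤ : ∀ {q r} → 0ℚ ≤ q → 0ℚ ≤ r →
          ℕᵇ.toℕ (numᵇ q ℕᵇ.* denᵇ r) ℕ.≤ ℕᵇ.toℕ (numᵇ r ℕᵇ.* denᵇ q) → q ≤ r
cross-≤ {q@(mkℚ (ℤ.+ a) d₁ _)} {r@(mkℚ (ℤ.+ b) d₂ _)} 0≤q 0≤r le = *≤* (subst₂ ℤ._≤_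
  (ℤ.pos-* a (suc d₂)) (ℤ.pos-* b (suc d₁)) (ℤ.+≤+ (subst₂ ℕ._≤_ (toℕ-cross q r) (toℕ-cross r q) le)))
cross-≤ {mkℚ -[1+ _ ] _ _} (*≤* ()) _ _
cross-≤ {mkℚ (ℤ.+ _) _ _} {mkℚ -[1+ _ ] _ _} _ (*≤* ()) _

rateItem : Tree → Tree → ℚ → Item
rateItem f c q = item f c (numᵇ q) (denᵇ q)

-- The product with denominator 0 is 0 and exceeds nothing, so the first type visited always
-- replaces `none`.
worse-none : ∀ f c q → worse (rateItem f c q) none ≡ false
worse-none f c q with exceeds (numᵇ q ℕᵇ.* zero) (one ℕᵇ.* denᵇ q) false
                    | exceeds-outcome (numᵇ q ℕᵇ.* zero) (one ℕᵇ.* denᵇ q) false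
... | false | _ = refl
... | true  | greater lt = contradiction
  (subst (ℕᵇ.toℕ (one ℕᵇ.* denᵇ q) ℕ.<_)
    (trans (ℕᵇ.toℕ-homo-* (numᵇ q) zero) (ℕ.*-zeroʳ (ℕᵇ.toℕ (numᵇ q)))) lt) ℕ.n≮0

-- The machine counts of a solution that uses a single machine, of type i.
δ : ∀ {m} → Fin m → Fin m → ℕ
δ zero    zero    = 1
δ zero    (suc _) = 0
δ (suc _) zero    = 0
δ (suc i) (suc j) = δ i j

bestAt : ∀ {m} → (Fin m → ℚ) → Fin m → Best
bestAt {m} σ i = best (numᵇ (σ i)) (denᵇ (σ i)) (ℕᵇ.fromℕ (Fin.toℕ i))
  (encodeList (encodeℕ ∘ δ i)) (encodeList {m} (λ _ → leaf))

suc-+one : ∀ n → ℕᵇ.fromℕ n ℕᵇ.+ one ≡ ℕᵇ.fromℕ (suc n)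
suc-+one n = trans (sym (ℕᵇ.fromℕ-homo-+ n 1)) (cong ℕᵇ.fromℕ (ℕ.+-comm n 1))

-- The right fold settles the tail first. If its winner `i` survives, it becomes `suc i`, matching
-- the incremented binary index and the extra zero count; otherwise transitivity makes the new rate
-- least. The initial `Fin m` ensures that some type exists.
pick-least : ∀ {m} → Fin m → (f c : Fin m → Tree) (σ : Fin m → ℚ) → (∀ i → 0ℚ ≤ σ i) →
  ∃[ i ] (∀ j → σ i ≤ σ j) ×
    foldr pick none (List.tabulate (λ i → rateItem (f i) (c i) (σ i))) ≡ bestAt σ i
pick-least {suc zero} _ f c σ 0≤σ = zero , (λ { zero → ≤-refl }) ,
  cong (λ w → select w (rateItem (f zero) (c zero) (σ zero)) none) (worse-none (f zero) (c zero) (σ zero))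
pick-least {suc (suc m)} _ f c σ 0≤σ with pick-least zero (f ∘ suc) (c ∘ suc) (σ ∘ suc) (0≤σ ∘ suc)
... | i , least , eq rewrite eq
  with worse (rateItem (f zero) (c zero) (σ zero)) (bestAt (σ ∘ suc) i)
     | exceeds-outcome (numᵇ (σ zero) ℕᵇ.* denᵇ (σ (suc i))) (numᵇ (σ (suc i)) ℕᵇ.* denᵇ (σ zero)) false
... | true  | out = suc i , least′ , cong
  (λ k → best (numᵇ (σ (suc i))) (denᵇ (σ (suc i))) k
              (encodeList (encodeℕ ∘ δ (suc i))) (encodeList {suc (suc m)} (λ _ → leaf)))
  (suc-+one (Fin.toℕ i))
  where
  least′ : ∀ j → σ (suc i) ≤ σ j
  least′ zero    = cross-≤ (0≤σ (suc i)) (0≤σ zero) (outcome-≥ out refl)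
  least′ (suc j) = least j
... | false | out = zero , least′ , refl
  where
  least′ : ∀ j → σ zero ≤ σ j
  least′ zero    = ≤-refl
  least′ (suc j) = ≤-trans (cross-≤ (0≤σ zero) (0≤σ (suc i)) (outcome-≤ out refl)) (least j)

itemsTree-tabulate : ∀ {m} (it : Fin m → Item) → itemsTree (List.tabulate it) ≡ encodeList (itemTree ∘ it)
itemsTree-tabulate {zero}  it = refl
itemsTree-tabulate {suc m} it = cong (itemTree (it zero) ∙_) (itemsTree-tabulate (it ∘ suc))

constant-encodeList : ∀ {n} (t : Fin n → Tree) e → constant (encodeList t) e ≡ encodeList {n} (λ _ → e)
constant-encodeList {zero}  t e = refl
constant-encodeList {suc n} t e = cong (e ∙_) (constant-encodeList (t ∘ suc) e)

size-encodeList : ∀ {n} (t : Fin n → Tree) i → size (t i) ℕ.≤ size (encodeList t)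
size-encodeList t zero    = ℕ.≤-trans (ℕ.m≤m+n _ _) (ℕ.n≤1+n _)
size-encodeList t (suc i) = ℕ.≤-trans (size-encodeList (t ∘ suc) i) (ℕ.≤-trans (ℕ.m≤n+m _ _) (ℕ.n≤1+n _))

size-left-≤ : ∀ {n} t u → size (t ∙ u) ℕ.≤ n → size t ℕ.≤ n
size-left-≤ t u = ℕ.≤-trans (size-left (t ∙ u))

size-right-≤ : ∀ {n} t u → size (t ∙ u) ℕ.≤ n → size u ℕ.≤ n
size-right-≤ t u = ℕ.≤-trans (size-right (t ∙ u))

module _ (I : Instance) where
  open Instance I

  instanceItem : Fin m → Item
  instanceItem i = rateItem (encodeℚ≥0 (f i)) (encodeℚ≥0 (c i)) (σ i)

  encodeInstance-≡ : encodeInstance I ≡ encodeList (encodeℚ≥0 ∘ p) ∙ itemsTree (List.tabulate instanceItem)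
  encodeInstance-≡ = cong (encodeList (encodeℚ≥0 ∘ p) ∙_) (sym (itemsTree-tabulate instanceItem))

  instanceItem-small : ∀ i → AtSize.Small ∥ I ∥ (instanceItem i)
  instanceItem-small i = record
    { n>0   = subst (0 ℕ.<_) (sym (ℕᵇ.toℕ-fromℕ _)) (positive-num (σ>0 i))
    ; n<2^N = ℕ.<-≤-trans (toℕ<2^size (numᵇ (σ i))) 
        (ℕ.^-monoʳ-≤ 2 (size-left-≤ ⌜ numᵇ (σ i) ⌝ ⌜ denᵇ (σ i) ⌝ rate≤))
    ; d<2^N = ℕ.<-≤-trans (toℕ<2^size (denᵇ (σ i))) 
        (ℕ.^-monoʳ-≤ 2 (size-right-≤ ⌜ numᵇ (σ i) ⌝ ⌜ denᵇ (σ i) ⌝ rate≤))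
    }
    where
    positive-num : ∀ {q} → 0ℚ < q → 0 ℕ.< ℤ.∣ ↥ q ∣
    positive-num {mkℚ (ℤ.+ suc _) _ _}  _ = s≤s z≤n
    positive-num {mkℚ (ℤ.+ zero) _ _}  (*<* (ℤ.+<+ ()))
    positive-num {mkℚ -[1+ _ ] _ _}  _ = s≤s z≤n
    rate≤ : size (⌜ numᵇ (σ i) ⌝ ∙ ⌜ denᵇ (σ i) ⌝) ℕ.≤ ∥ I ∥
    rate≤ = size-right-≤ (encodeℚ≥0 (c i)) (encodeℚ≥0 (σ i))
      (size-right-≤ (encodeℚ≥0 (f i)) (encodeℚ≥0 (c i) ∙ encodeℚ≥0 (σ i))
        (ℕ.≤-trans (size-encodeList (itemTree ∘ instanceItem) i) (size-right (encodeInstance I))))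

theMachine : ∀ {m} (i : Fin m) → Fin (δ i i)
theMachine zero    = zero
theMachine (suc i) = theMachine i

toℕ-theMachine : ∀ {m} (i : Fin m) → Fin.toℕ (theMachine i) ≡ 0
toℕ-theMachine zero    = refl
toℕ-theMachine (suc i) = toℕ-theMachine i

single : (I : Instance) → Fin (Instance.m I) → Solution I
single I i = record { count = δ i ; assign = λ _ → i , theMachine i }

solverProgram : Program
solverProgram = record { body = solver }

solver-outputs : (I : Instance) → Fin (Instance.m I) →
  ∃[ i ] (∀ j → Instance.σ I i ≤ Instance.σ I j) ×
  ∃[ t ] (solverProgram on encodeInstance I outputs encodeSolution (single I i) inTime t) ×
         t ℕ.≤ AtSize.solverTime ∥ I ∥
solver-outputs I i₀ =
  let i , least , eq            = picked i₀
      ρ , within {t} halts t≤   = AtSize.exec-solver ∥ I ∥ jobs items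
                                    (ℕ.≤-reflexive (cong size (sym (encodeInstance-≡ I))))
                                    (quadratic≤bound ∥ I ∥) (LAll.tabulate⁺ (instanceItem-small I))
  in i , least , t ,
     (_ , subst (λ x → ⟨ solver , x ∷ Vec.replicate 18 leaf ⟩⇓[ t ] (output (foldr pick none items) ∷ ρ))
              (sym (encodeInstance-≡ I)) halts
        , trans (cong output eq) (encoded i)) ,
     t≤
  where
  open Instance I
  jobs = encodeList (encodeℚ≥0 ∘ p)
  items = List.tabulate (instanceItem I)
  output : Best → Tree
  output s = Best.counts s ∙ constant jobs (⌜ Best.index s ⌝ ∙ leaf)
  picked : Fin m → ∃[ i ] (∀ j → σ i ≤ σ j) × foldr pick none items ≡ bestAt σ i
  picked i₀ = pick-least i₀ (encodeℚ≥0 ∘ f) (encodeℚ≥0 ∘ c) σ (<⇒≤ ∘ σ>0)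
  encoded : ∀ i → encodeList (encodeℕ ∘ δ i) ∙ constant jobs (encodeℕ (Fin.toℕ i) ∙ leaf) ≡
                  encodeSolution (single I i)
  encoded i = cong (encodeList (encodeℕ ∘ δ i) ∙_) (trans (constant-encodeList (encodeℚ≥0 ∘ p) _)
    (cong (λ k → encodeList {n} (λ _ → encodeℕ (Fin.toℕ i) ∙ encodeℕ k)) (sym (toℕ-theMachine i))))

private variable
  k : ℕ

-- Costs of solutions

∑-cong : {f g : Fin k → ℚ} → (∀ i → f i ≡ g i) → ∑ f ≡ ∑ g
∑-cong = sum-cong-≗ +-0-commutativeMonoid

∑-swap : ∀ {m n} (f : Fin m → Fin n → ℚ) → ∑ (λ i → ∑ (f i)) ≡ ∑ (λ j → ∑ (λ i → f i j))
∑-swap = ∑-comm +-0-commutativeMonoid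

∑-mono-≤ : {f g : Fin k → ℚ} → (∀ i → f i ≤ g i) → ∑ f ≤ ∑ g
∑-mono-≤ {zero}  f≤g = ≤-refl
∑-mono-≤ {suc k} f≤g = +-mono-≤ (f≤g zero) (∑-mono-≤ (f≤g ∘ suc))

∑-nonNeg : {f : Fin k → ℚ} → (∀ i → 0ℚ ≤ f i) → 0ℚ ≤ ∑ f
∑-nonNeg {k} 0≤f = ≤-trans (≤-reflexive (sym (sum-replicate-zero +-0-commutativeMonoid k))) (∑-mono-≤ 0≤f)

≤-+-nonNegʳ : ∀ p {q} → 0ℚ ≤ q → p ≤ p + q
≤-+-nonNegʳ p 0≤q = ≤-trans (≤-reflexive (sym (+-identityʳ p))) (+-monoʳ-≤ p 0≤q)

≤-+-nonNegˡ : ∀ p {q} → 0ℚ ≤ q → p ≤ q + p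
≤-+-nonNegˡ p 0≤q = ≤-trans (≤-reflexive (sym (+-identityˡ p))) (+-monoˡ-≤ p 0≤q)

term≤∑ : {f : Fin k → ℚ} → (∀ i → 0ℚ ≤ f i) → ∀ i → f i ≤ ∑ f
term≤∑ {f = f} 0≤f zero    = ≤-+-nonNegʳ (f zero) (∑-nonNeg (0≤f ∘ suc))
term≤∑ {f = f} 0≤f (suc i) = ≤-trans (term≤∑ (0≤f ∘ suc) i) (≤-+-nonNegˡ _ (0≤f zero))

*-distribˡ-∑ : ∀ a (f : Fin k → ℚ) → a * ∑ f ≡ ∑ (λ i → a * f i)
*-distribˡ-∑ {zero}  a f = *-zeroʳ a
*-distribˡ-∑ {suc k} a f = 
  trans (*-distribˡ-+ a (f zero) _) (cong ((a * f zero) +_) (*-distribˡ-∑ a (f ∘ suc)))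

∑-const : ∀ k a → ∑ {k} (λ _ → a) ≡ fromℕ k * a
∑-const zero    a = sym (*-zeroˡ a)
∑-const (suc k) a = begin
  a + ∑ {k} (λ _ → a)      ≡⟨ cong₂ _+_ (sym (*-identityˡ a)) (∑-const k a) ⟩
  1ℚ * a + fromℕ k * a     ≡⟨ *-distribʳ-+ a 1ℚ (fromℕ k) ⟨
  (1ℚ + fromℕ k) * a       ≡⟨ cong (_* a) (fromℕ-+ 1 k) ⟨
  fromℕ (suc k) * a        ∎
  where open ≡-Reasoning

-- All inner sums except that of type `i` range over `Fin 0`. The dependent form fits the double sum
-- in `cost` directly.
∑-δ : ∀ {m} (i : Fin m) (g : ∀ j → Fin (δ i j) → ℚ) → ∑ (λ j → ∑ (g j)) ≡ g i (theMachine i)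
∑-δ {suc m} zero    g = trans (cong ((g zero zero + 0ℚ) +_) (sum-replicate-zero +-0-commutativeMonoid m))
                       (trans (+-identityʳ _) (+-identityʳ _))
∑-δ {suc m} (suc i) g = trans (+-identityˡ _) (∑-δ i (g ∘ suc))

*-nonNeg : ∀ {p q} → 0ℚ ≤ p → 0ℚ ≤ q → 0ℚ ≤ p * q
*-nonNeg {p} {q} 0≤p 0≤q =
  ≤-trans (≤-reflexive (sym (*-zeroʳ p))) (*-monoˡ-≤-nonNeg p {{nonNegative 0≤p}} 0≤q)

p≤q⇒0≤q-p : ∀ {p q} → p ≤ q → 0ℚ ≤ q - p
p≤q⇒0≤q-p {p} {q} p≤q = ≤-trans (≤-reflexive (sym (+-inverseʳ p))) (+-monoˡ-≤ (- p) p≤q)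

module _ (I : Instance) where
  open Instance I

  totalSize : ℚ
  totalSize = ∑ p

  -- Standard capacity is paid at the same rate as overtime, so the overtime formula is linear
  -- through the origin.
  rate-cost : ∀ i L → σ i * L ≡ f i + σ i * (L - c i)
  rate-cost i L = begin
    σ i * L                          ≡⟨ cong (σ i *_) L≡ ⟩
    σ i * (c i + (L - c i))          ≡⟨ *-distribˡ-+ (σ i) (c i) (L - c i) ⟩
    σ i * c i + σ i * (L - c i)      ≡⟨ cong (_+ σ i * (L - c i))
                                             (trans (*-comm (σ i) (c i)) (sym (f≡c*σ i))) ⟩
    f i + σ i * (L - c i)            ∎
    where
    open ≡-Reasoning
    L≡ : L ≡ c i + (L - c i)
    L≡ = begin
      L                    ≡⟨ +-identityʳ L ⟨
      L + 0ℚ               ≡⟨ cong (L +_) (+-inverseˡ (c i)) ⟨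
      L + (- c i + c i)    ≡⟨ +-assoc L (- c i) (c i) ⟨
      (L - c i) + c i      ≡⟨ +-comm (L - c i) (c i) ⟩
      c i + (L - c i)      ∎

  rate≤machineCost : ∀ i L → σ i * L ≤ machineCost I i L
  rate≤machineCost i L with L ≤? c i
  ... | yes L≤c = ≤-trans (*-monoˡ-≤-nonNeg (σ i) {{nonNegative (<⇒≤ (σ>0 i))}} L≤c)
                          (≤-reflexive (trans (*-comm (σ i) (c i)) (sym (f≡c*σ i))))
  ... | no  _   = ≤-reflexive (rate-cost i L)

  fixed≤machineCost : ∀ i L → f i ≤ machineCost I i L
  fixed≤machineCost i L with L ≤? c i
  ... | yes _   = ≤-refl
  ... | no  L≰c = ≤-+-nonNegʳ (f i) (*-nonNeg (<⇒≤ (σ>0 i)) (p≤q⇒0≤q-p (<⇒≤ (≰⇒> L≰c))))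

  machineCost≤ : ∀ i {L} → 0ℚ ≤ L → machineCost I i L ≤ f i + σ i * L
  machineCost≤ i {L} 0≤L with L ≤? c i
  ... | yes _ = ≤-+-nonNegʳ (f i) (*-nonNeg (<⇒≤ (σ>0 i)) 0≤L)
  ... | no  _ = ≤-trans (≤-reflexive (sym (rate-cost i L))) (≤-+-nonNegˡ _ (<⇒≤ (f>0 i)))

  module _ (s : Solution I) where
    open Solution s

    share : Fin n → (i : Fin m) → Fin (count i) → ℚ
    share j i l = if ⌊ ≡-dec Fin._≟_ Fin._≟_ (assign j) (i , l) ⌋ then p j else 0ℚ

    share≥0 : ∀ j i l → 0ℚ ≤ share j i l
    share≥0 j i l with ⌊ ≡-dec Fin._≟_ Fin._≟_ (assign j) (i , l) ⌋
    ... | true  = p≥0 j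
    ... | false = ≤-refl

    share≤ : ∀ j i l → share j i l ≤ p j
    share≤ j i l with ⌊ ≡-dec Fin._≟_ Fin._≟_ (assign j) (i , l) ⌋
    ... | true  = ≤-refl
    ... | false = p≥0 j

    share-assigned : ∀ j → share j (proj₁ (assign j)) (proj₂ (assign j)) ≡ p j
    share-assigned j with ≡-dec Fin._≟_ Fin._≟_ (assign j) (assign j)
    ... | yes _  = refl
    ... | no x≢x = contradiction refl x≢x

    load≥0 : ∀ i l → 0ℚ ≤ load s i l
    load≥0 i l = ∑-nonNeg (λ j → share≥0 j i l)

    -- Double counting of the shares: the sum over machines is bounded below, for each job, by the
    -- one term of its assigned machine, and the sums are then exchanged.
    totalSize≤loads : totalSize ≤ ∑ (λ i → ∑ (load s i))
    totalSize≤loads = begin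
      ∑ p                                        ≤⟨ ∑-mono-≤ p≤ ⟩
      ∑ (λ j → ∑ (λ i → ∑ (λ l → share j i l)))  ≡⟨ ∑-swap (λ i j → ∑ (λ l → share j i l)) ⟨
      ∑ (λ i → ∑ (λ j → ∑ (λ l → share j i l)))  ≡⟨ ∑-cong (λ i → ∑-swap (λ l j → share j i l)) ⟨
      ∑ (λ i → ∑ (load s i))                     ∎
      where
      open ≤-Reasoning
      p≤ : ∀ j → p j ≤ ∑ (λ i → ∑ (λ l → share j i l))
      p≤ j = begin
        p j                              ≡⟨ share-assigned j ⟨
        share j i l                      ≤⟨ term≤∑ (share≥0 j i) l ⟩
        ∑ (share j i)                    ≤⟨ term≤∑ (λ i → ∑-nonNeg (share≥0 j i)) i ⟩
        ∑ (λ i → ∑ (λ l → share j i l))  ∎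
        where
        i = proj₁ (assign j)
        l = proj₂ (assign j)

    rate≤cost : ∀ {τ} → 0ℚ ≤ τ → (∀ i → τ ≤ σ i) → τ * totalSize ≤ cost s
    rate≤cost {τ} 0≤τ τ≤σ = begin
      τ * totalSize                          ≤⟨ *-monoˡ-≤-nonNeg τ {{nonNegative 0≤τ}} totalSize≤loads ⟩
      τ * ∑ (λ i → ∑ (load s i))             ≡⟨ *-distribˡ-∑ τ (λ i → ∑ (load s i)) ⟩
      ∑ (λ i → τ * ∑ (load s i))             ≡⟨ ∑-cong (λ i → *-distribˡ-∑ τ (load s i)) ⟩
      ∑ (λ i → ∑ (λ l → τ * load s i l))     ≤⟨ ∑-mono-≤ (λ i → ∑-mono-≤ (machine i)) ⟩
      cost s                                 ∎
      where
      open ≤-Reasoning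
      machine : ∀ i l → τ * load s i l ≤ machineCost I i (load s i l)
      machine i l = ≤-trans (*-monoʳ-≤-nonNeg (load s i l) {{nonNegative (load≥0 i l)}} (τ≤σ i))
                            (rate≤machineCost i (load s i l))

    machineCosts≥0 : ∀ i l → 0ℚ ≤ machineCost I i (load s i l)
    machineCosts≥0 i l = ≤-trans (<⇒≤ (f>0 i)) (fixed≤machineCost i (load s i l))

    -- Even an idle machine pays its fixed cost, so cheap solutions have few machines; this makes
    -- the search for an optimum finite.
    count*fixed≤cost : ∀ i → fromℕ (count i) * f i ≤ cost s
    count*fixed≤cost i = begin
      fromℕ (count i) * f i                        ≡⟨ ∑-const (count i) (f i) ⟨
      ∑ {count i} (λ _ → f i)                      ≤⟨ ∑-mono-≤ (λ l → fixed≤machineCost i (load s i l)) ⟩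
      ∑ (λ l → machineCost I i (load s i l))       ≤⟨ term≤∑ (λ i → ∑-nonNeg (machineCosts≥0 i)) i ⟩
      cost s                                       ∎
      where open ≤-Reasoning

  cost-single : ∀ i → cost (single I i) ≤ f i + σ i * totalSize
  cost-single i = begin
    cost s                                      ≡⟨ ∑-δ i (λ j l → machineCost I j (load s j l)) ⟩
    machineCost I i L                           ≤⟨ machineCost≤ i (load≥0 s i (theMachine i)) ⟩
    f i + σ i * L                               ≤⟨ +-monoʳ-≤ (f i)
                                                     (*-monoˡ-≤-nonNeg (σ i) {{nonNegative (<⇒≤ (σ>0 i))}}
                                                       (∑-mono-≤ (λ j → share≤ s j i (theMachine i)))) ⟩
    f i + σ i * totalSize                       ∎
    where
    open ≤-Reasoning
    s = single I i
    L = load s i (theMachine i)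

-- Existence of optimal solutions

≤-∣↥∣ : ∀ q → q ≤ fromℕ ℤ.∣ ↥ q ∣
≤-∣↥∣ q@(mkℚ (ℤ.+ a) d _) rewrite fromℕ-mkℚ a =
  *≤* (ℤ.*-monoˡ-≤-nonNeg (ℤ.+ a) (ℤ.+≤+ (s≤s z≤n)))
≤-∣↥∣ q@(mkℚ -[1+ a ] d _) rewrite fromℕ-mkℚ (suc a) = *≤* ℤ.-≤+

-- The denominator times `q` is the numerator, a positive integer. This provides the factor `↧ₙ a`
-- in `archimedean`.
1≤↧* : ∀ q → 0ℚ < q → 1ℚ ≤ fromℕ (↧ₙ q) * q
1≤↧* q@(mkℚ (ℤ.+ suc a) d _) _ rewrite fromℕ-mkℚ (suc d) =
  toℚᵘ-cancel-≤ (ℚᵘ.≤-respʳ-≃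
    (ℚᵘ.≃-sym (toℚᵘ-homo-* (mkℚ (ℤ.+ suc d) 0 (coprime-sym (1-coprimeTo (suc d)))) q)) (ℚᵘ.*≤* le))
  where
  le : ℤ.+ 1 ℤ.* (ℤ.+ (1 ℕ.* suc d)) ℤ.≤ (ℤ.+ suc d ℤ.* ℤ.+ suc a) ℤ.* ℤ.+ 1
  le = subst₂ ℤ._≤_ (sym (trans (ℤ.*-identityˡ _) (cong ℤ.+_ (ℕ.*-identityˡ (suc d)))))
                    (sym (trans (ℤ.*-identityʳ _) (sym (ℤ.pos-* (suc d) (suc a)))))
                    (ℤ.+≤+ (ℕ.m≤m*n (suc d) (suc a)))
1≤↧* (mkℚ (ℤ.+ zero) _ _) (*<* (ℤ.+<+ ()))
1≤↧* (mkℚ -[1+ _ ] _ _) (*<* ())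

fromℕ≥0 : ∀ k → 0ℚ ≤ fromℕ k
fromℕ≥0 k = fromℕ-mono-≤ {0} {k} z≤n

≤-fromℕ-* : ∀ {a b} u d → b ≤ fromℕ u → 1ℚ ≤ fromℕ d * a → b ≤ fromℕ (u ℕ.* d) * a
≤-fromℕ-* {a} {b} u d b≤u 1≤d*a = begin
  b                        ≤⟨ b≤u ⟩
  fromℕ u                  ≡⟨ *-identityʳ (fromℕ u) ⟨
  fromℕ u * 1ℚ             ≤⟨ *-monoˡ-≤-nonNeg (fromℕ u) {{nonNegative (fromℕ≥0 u)}} 1≤d*a ⟩
  fromℕ u * (fromℕ d * a)  ≡⟨ *-assoc (fromℕ u) (fromℕ d) a ⟨
  fromℕ u * fromℕ d * a    ≡⟨ cong (_* a) (fromℕ-* u d) ⟨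
  fromℕ (u ℕ.* d) * a      ∎
  where open ≤-Reasoning

opaque
  archimedean : ∀ b {a} → 0ℚ < a → ∃[ k ] b ≤ fromℕ k * a
  archimedean b {a} 0<a =
    ℤ.∣ ↥ b ∣ ℕ.* ↧ₙ a , ≤-fromℕ-* ℤ.∣ ↥ b ∣ (↧ₙ a) (≤-∣↥∣ b) (1≤↧* a 0<a)

-- Enumeration of the solutions with bounded machine counts

module _ {A : Set} where

  choices : ∀ {n} → (Fin n → List A) → List (Vec A n)
  choices {zero}  ls = [] ∷ []
  choices {suc n} ls = cartesianProductWith _∷_ (ls zero) (choices (ls ∘ suc))

  ∈-choices : ∀ {n} {ls : Fin n → List A} {f : Fin n → A} → (∀ i → f i ∈ ls i) → tabulate f ∈ choices ls
  ∈-choices {zero}  f∈ls = here refl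
  ∈-choices {suc n} f∈ls = ∈-cartesianProductWith⁺ _∷_ (f∈ls zero) (∈-choices (f∈ls ∘ suc))

machines : ∀ {m} (count : Fin m → ℕ) → List (Σ (Fin m) (Fin ∘ count))
machines {m} count = concatMap (λ i → map (i ,_) (allFin (count i))) (allFin m)

∈-machines : ∀ {m} (count : Fin m → ℕ) x → x ∈ machines count
∈-machines {m} count (i , l) = ∈-concatMap⁺ (λ i → map (i ,_) (allFin (count i)))
  (lose (∈-allFin i) (∈-map⁺ (i ,_) (∈-allFin l)))

∑-subst : ∀ {k k′} (eq : k ≡ k′) {f : Fin k → ℚ} {g : Fin k′ → ℚ} →
          (∀ l → f l ≡ g (subst Fin eq l)) → ∑ f ≡ ∑ g
∑-subst refl f≡g = ∑-cong f≡g

⌊≟⌋-injective : ∀ {A B : Set} (_≟_ : DecidableEquality A) (_≟′_ : DecidableEquality B) {φ : A → B} →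
  (∀ {x y} → φ x ≡ φ y → x ≡ y) → ∀ x y → ⌊ x ≟ y ⌋ ≡ ⌊ φ x ≟′ φ y ⌋
⌊≟⌋-injective _≟_ _≟′_ {φ} inj x y with x ≟ y | φ x ≟′ φ y
... | yes _   | yes _     = refl
... | no  _   | no  _     = refl
... | yes x≡y | no  φx≢φy = contradiction (cong φ x≡y) φx≢φy
... | no  x≢y | yes φx≡φy = contradiction (inj φx≡φy) x≢y

module _ {I : Instance} where
  open Instance I
  open Solution

  module _ (s : Solution I) {count′ : Fin m → ℕ} (eq : ∀ i → count s i ≡ count′ i) where

    private
      φ : Σ (Fin m) (Fin ∘ count s) → Σ (Fin m) (Fin ∘ count′)
      φ (i , l) = i , subst Fin (eq i) l

      ψ : Σ (Fin m) (Fin ∘ count′) → Σ (Fin m) (Fin ∘ count s)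
      ψ (i , l) = i , subst Fin (sym (eq i)) l

      ψφ : ∀ x → ψ (φ x) ≡ x
      ψφ (i , l) = cong (i ,_) (subst-sym-subst (eq i))

      φ-injective : ∀ {x y} → φ x ≡ φ y → x ≡ y
      φ-injective {x} {y} φx≡φy = trans (sym (ψφ x)) (trans (cong ψ φx≡φy) (ψφ y))

    relabel : Fin n → Σ (Fin m) (Fin ∘ count′)
    relabel j = φ (assign s j)

    -- Equal counts are only propositionally equal, so machine numbers are transported along `eq`.
    -- The transport `φ` is injective, hence every test whether a job is on a machine keeps its
    -- outcome.
    cost-relabel : (a : Fin n → Σ (Fin m) (Fin ∘ count′)) → (∀ j → relabel j ≡ a j) →
      cost s ≡ cost {I} (record { count = count′ ; assign = a })
    cost-relabel a a≡ = ∑-cong (λ i → ∑-subst (eq i) (λ l → cong (machineCost I i) (∑-cong (job i l))))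
      where
      job : ∀ i l j →
        (if ⌊ ≡-dec Fin._≟_ Fin._≟_ (assign s j) (i , l) ⌋ then p j else 0ℚ) ≡
        (if ⌊ ≡-dec Fin._≟_ Fin._≟_ (a j) (i , subst Fin (eq i) l) ⌋ then p j else 0ℚ)
      job i l j rewrite sym (a≡ j) = cong (λ b → if b then p j else 0ℚ)
        (⌊≟⌋-injective (≡-dec Fin._≟_ Fin._≟_) (≡-dec Fin._≟_ Fin._≟_) φ-injective (assign s j) (i , l))

module _ (I : Instance) where
  open Instance I
  open Solution

  fromVecs : (v : Vec ℕ m) → Vec (Σ (Fin m) (Fin ∘ lookup v)) n → Solution I
  fromVecs v a = record { count = lookup v ; assign = lookup a }

  assignments : (count : Vec ℕ m) → List (Solution I)
  assignments v = map (fromVecs v) (choices {n = n} (λ _ → machines (lookup v)))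

  solutions : (Fin m → ℕ) → List (Solution I)
  solutions K = concatMap assignments (choices (λ i → upTo (suc (K i))))

  -- Solutions contain functions, which need not be equal to their tabulations without
  -- extensionality. So a solution is matched with a listed one only up to cost, which is enough for
  -- minimisation.
  solutions-complete : ∀ K (s : Solution I) → (∀ i → count s i ℕ.≤ K i) →
    ∃[ s′ ] s′ ∈ solutions K × cost s ≡ cost s′
  solutions-complete K s count≤K = fromVecs v a ,
    ∈-concatMap⁺ assignments (lose v∈ (∈-map⁺ (fromVecs v) a∈)) ,
    cost-relabel s eq (lookup a) (λ j → sym (lookup∘tabulate (relabel s eq) j))
    where
    v : Vec ℕ m
    v = tabulate (count s)
    eq : ∀ i → count s i ≡ lookup v i
    eq i = sym (lookup∘tabulate (count s) i)
    a : Vec (Σ (Fin m) (Fin ∘ lookup v)) n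
    a = tabulate (relabel s eq)
    v∈ : v ∈ choices (λ i → upTo (suc (K i)))
    v∈ = ∈-choices (λ i → ∈-upTo⁺ (s≤s (count≤K i)))
    a∈ : a ∈ choices (λ _ → machines (lookup v))
    a∈ = ∈-choices (λ j → ∈-machines (lookup v) (relabel s eq j))

  -- A solution cheaper than s₀ cannot have more than cost s₀ / f i machines of
  -- type i, which leaves finitely many candidates.
  optimal-exists : Solution I → Σ[ o ∈ Solution I ] Optimal o
  optimal-exists s₀ = o , optimal
    where
    K : Fin m → ℕ
    K i = proj₁ (archimedean (cost s₀) (f>0 i))
    o : Solution I
    o = argmin cost s₀ (solutions K)
    count≤K : ∀ s → ¬ cost s₀ ≤ cost s → ∀ i → count s i ℕ.≤ K i
    count≤K s s₀≰s i = ℕ.≮⇒≥ λ K<count → s₀≰s (begin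
      cost s₀                  ≤⟨ proj₂ (archimedean (cost s₀) (f>0 i)) ⟩
      fromℕ (K i) * f i        ≤⟨ *-monoʳ-≤-nonNeg (f i) {{nonNegative (<⇒≤ (f>0 i))}}
                                    (fromℕ-mono-≤ {K i} {count s i} (ℕ.<⇒≤ K<count)) ⟩
      fromℕ (count s i) * f i  ≤⟨ count*fixed≤cost I s i ⟩
      cost s                   ∎)
      where open ≤-Reasoning
    -- A solution at least as expensive as `s₀` is covered by the default value of `argmin`; a
    -- cheaper one occurs in the list up to cost.
    compare : ∀ s → Dec (cost s₀ ≤ cost s) → cost o ≤ cost s
    compare s (yes s₀≤s) = ≤-trans (f[argmin]≤f[⊤] {f = cost} s₀ (solutions K)) s₀≤s
    compare s (no  s₀≰s) =
      let s′ , s′∈ , eq = solutions-complete K s (count≤K s s₀≰s)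
      in ≤-trans (LAll.lookup (f[argmin]≤f[xs] {f = cost} s₀ (solutions K)) s′∈) (≤-reflexive (sym eq))
    optimal : Optimal o
    optimal s = compare s (cost s₀ ≤? cost s)

-- The approximation guarantee

single-≤ : (I : Instance) → (∀ i → Instance.f I i ≤ 1ℚ) →
  ∀ i → (∀ j → Instance.σ I i ≤ Instance.σ I j) →
  (ε : ℚ) .{{_ : Positive ε}} (o : Solution I) → cost (single I i) ≤ (1ℚ + ε) * cost o + 1ℚ
single-≤ I f≤1 i least ε o = begin
  cost (single I i)                 ≤⟨ cost-single I i ⟩
  f i + σ i * totalSize I           ≤⟨ +-mono-≤ (f≤1 i) σP≤o ⟩
  1ℚ + cost o                       ≤⟨ +-monoʳ-≤ 1ℚ (≤-+-nonNegʳ (cost o) (*-nonNeg 0≤ε 0≤o)) ⟩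
  1ℚ + (cost o + ε * cost o)        ≡⟨ cong (λ c → 1ℚ + (c + ε * cost o)) (*-identityˡ (cost o)) ⟨
  1ℚ + (1ℚ * cost o + ε * cost o)   ≡⟨ cong (1ℚ +_) (*-distribʳ-+ (cost o) 1ℚ ε) ⟨
  1ℚ + (1ℚ + ε) * cost o            ≡⟨ +-comm 1ℚ ((1ℚ + ε) * cost o) ⟩
  (1ℚ + ε) * cost o + 1ℚ            ∎
  where
  open Instance I
  open ≤-Reasoning
  0≤ε : 0ℚ ≤ ε
  0≤ε = nonNegative⁻¹ ε {{pos⇒nonNeg ε}}
  σP≤o : σ i * totalSize I ≤ cost o
  σP≤o = rate≤cost I o (<⇒≤ (σ>0 i)) least
  0≤o : 0ℚ ≤ cost o
  0≤o = ≤-trans (*-nonNeg (<⇒≤ (σ>0 i)) (∑-nonNeg p≥0)) σP≤o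

theorem4 : Σ[ g ∈ (ℚ → ℚ) ] Σ[ q ∈ Poly₂ ] ((ε : ℚ) .{{_ : Positive ε}} →
    Σ[ P ∈ Program ] ((I : Instance) → MaxFixedCost I 1ℚ →
    Σ[ s ∈ Solution I ] Σ[ t ∈ ℕ ]
    (P on encodeInstance I outputs encodeSolution s inTime t) ×
    (fromℕ t ≤ ⟦ q ⟧ (inverse ε) (fromℕ ∥ I ∥)) ×
    (Σ[ o ∈ Solution I ] Optimal o × (cost s ≤ (1ℚ + ε) * cost o + g (inverse ε)))))
theorem4 = (λ _ → 1ℚ) , poly pSolver , λ ε → solverProgram ,
    -- The type attaining the maximal fixed cost shows that there is a type at all, from which the
    -- search for a least rate can start.
    λ I max → approximate ε I max (solver-outputs I (proj₁ (proj₂ max)))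
  where
  approximate : (ε : ℚ) .{{_ : Positive ε}} (I : Instance) → MaxFixedCost I 1ℚ →
    (∃[ i ] (∀ j → Instance.σ I i ≤ Instance.σ I j) ×
     ∃[ t ] (solverProgram on encodeInstance I outputs encodeSolution (single I i) inTime t) ×
            t ℕ.≤ AtSize.solverTime ∥ I ∥) →
    Σ[ s ∈ Solution I ] Σ[ t ∈ ℕ ]
      (solverProgram on encodeInstance I outputs encodeSolution s inTime t) ×
      (fromℕ t ≤ ⟦ poly pSolver ⟧ (inverse ε) (fromℕ ∥ I ∥)) ×
      (Σ[ o ∈ Solution I ] Optimal o × (cost s ≤ (1ℚ + ε) * cost o + 1ℚ))
  approximate ε I (f≤1 , _) (i , least , t , outputs , t≤) =
    single I i , t , outputs , polynomial-time {inverse ε} {∥ I ∥} t≤ ,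
    o , proj₂ (optimal-exists I (single I i)) , single-≤ I f≤1 i least ε o
    where o = proj₁ (optimal-exists I (single I i))
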